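{- JT-hardness coincides with BLR-hardness: for every set $B\subseteq\mathbb{N}$, $\emptyset'\le_{JT}B$ if and only if $\emptyset'\le_{BLR}B$.
   Context: Let $\{\Phi_n^X\}_{n\in\mathbb{N}}$ be a standard list of all functions partial computable in the oracle $X$, let $W_n^X$ be the domain of $\Phi_n^X$, and let $J^X(n)=\Phi_n^X(n)$. $X\le_{JT}Y$ ($X$ is jump traceable by $Y$) means there are computable functions $f,g$ such that for all $n$, if $J^X(n)\downarrow$ then $J^X(n)\in W_{f(n)}^Y$, and for all $n$, $W_{f(n)}^Y$ is finite of cardinality at most $g(n)$. $B$ is JT-hard if $\emptyset'\le_{JT}B$. For a set $A$, $\mathrm{BLR}(A)$ is the class of functions $f:\omega\to\omega$ for which there are an $A$-computable function $\tilde f:\omega\times\omega\to\omega$ and a computable function $g:\omega\to\omega$ (computable without oracle) such that for all $n$, $f(n)=\lim_s\tilde f(n,s)$ and the set $\{s:\tilde f(n,s)\ne\tilde f(n,s+1)\}$ has cardinality less than $g(n)$. $X\le_{BLR}Y$ means $\mathrm{BLR}(X)\subseteq\mathrm{BLR}(Y)$. $B$ is BLR-hard if $\emptyset'\le_{BLR}B$. -}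

module Defs where

open import Data.List using (List; length)
open import Data.List.Membership.Propositional using (_∈_)
open import Data.List.Relation.Unary.Unique.Propositional using (Unique)
open import Data.Nat using (ℕ; zero; suc; _+_; _≤_; _<_; s≤s)
open import Data.Nat.Properties
  using (+-suc; +-identityʳ; suc-injective; <-cmp; m≤m+n; m≤n+m; n<1+n;
         ≤-refl; ≤-reflexive; ≤-trans; <-≤-trans; ≤-<-trans)
open import Data.Product using (_×_; _,_; proj₁; proj₂; ∃-syntax)
open import Data.Sum using (_⊎_; inj₁; inj₂)
open import Function using (_⇔_)
open import Level using (0ℓ)
open import Relation.Binary using (tri<; tri≈; tri>)
open import Relation.Binary.PropositionalEquality
  using (_≡_; _≢_; refl; sym; trans; cong; cong₂)
open import Relation.Nullary using (¬_; contradiction)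
open import Relation.Unary using (Pred; ∅; _⊆_)

------------------------------------------------------------------------
-- Cantor's pairing bijection ℕ × ℕ ≅ ℕ

triangle : ℕ → ℕ
triangle zero    = zero
triangle (suc n) = suc n + triangle n

⟪_,_⟫ : ℕ → ℕ → ℕ
⟪ m , n ⟫ = n + triangle (m + n)

-- One step along the antidiagonals (0,0), (1,0), (0,1), (2,0), (1,1), …
next : ℕ × ℕ → ℕ × ℕ
next (zero  , n) = suc n , zero
next (suc m , n) = m , suc n

unpair : ℕ → ℕ × ℕ
unpair zero    = zero , zero
unpair (suc k) = next (unpair k)

left right : ℕ → ℕ
left  k = proj₁ (unpair k)
right k = proj₂ (unpair k)

⟪⟫-next : ∀ p → ⟪ proj₁ (next p) , proj₂ (next p) ⟫ ≡ suc ⟪ proj₁ p , proj₂ p ⟫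
⟪⟫-next (zero  , n) rewrite +-identityʳ n = refl
⟪⟫-next (suc m , n) rewrite +-suc m n     = refl

⟪left,right⟫ : ∀ k → ⟪ left k , right k ⟫ ≡ k
⟪left,right⟫ zero    = refl
⟪left,right⟫ (suc k) = trans (⟪⟫-next (unpair k)) (cong suc (⟪left,right⟫ k))

unpair-⟪⟫ : ∀ m n → unpair ⟪ m , n ⟫ ≡ (m , n)
unpair-⟪⟫ m n = go (m + n) m n refl
  where
  go : ∀ d m n → m + n ≡ d → unpair ⟪ m , n ⟫ ≡ (m , n)
  go d zero zero eq = refl
  go (suc d) (suc m) zero eq =
    trans (cong unpair (⟪⟫-next (zero , m)))
          (cong next (go d zero m (suc-injective (trans (cong suc (sym (+-identityʳ m))) eq))))
  go d m (suc n) eq =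
    trans (cong unpair (⟪⟫-next (suc m , n)))
          (cong next (go d (suc m) n (trans (sym (+-suc m n)) eq)))

------------------------------------------------------------------------
-- Functions partial computable in an oracle

-- A partial function is represented by its graph: F n y says that F is
-- defined at n with value y.
Graph : Set₁
Graph = ℕ → ℕ → Set

-- Kleene's schemes, for unary functions on ℕ with arguments packed by
-- the pairing function.
data Code : Set where
  zeroᶜ succᶜ leftᶜ rightᶜ oracleᶜ : Code
  pairᶜ compᶜ precᶜ : Code → Code → Code
  μᶜ : Code → Code

-- F n = characteristic function of X
oracle : Pred ℕ 0ℓ → Graph
oracle X n y = (X n × y ≡ 1) ⊎ (¬ X n × y ≡ 0)

primRec : Graph → Graph → ℕ → Graph
primRec F G a zero    y = F a y
primRec F G a (suc k) y = ∃[ z ] primRec F G a k z × G ⟪ a , ⟪ k , z ⟫ ⟫ y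

-- The value is the least zero, and F must be defined at all smaller
-- arguments.
minimize : Graph → Graph
minimize F n y = F ⟪ n , y ⟫ 0 × (∀ i → i < y → ∃[ v ] F ⟪ n , i ⟫ (suc v))

⟦_⟧ : Code → Pred ℕ 0ℓ → Graph
⟦ zeroᶜ     ⟧ X n y = y ≡ 0
⟦ succᶜ     ⟧ X n y = y ≡ suc n
⟦ leftᶜ     ⟧ X n y = y ≡ left n
⟦ rightᶜ    ⟧ X n y = y ≡ right n
⟦ oracleᶜ   ⟧ X n y = oracle X n y
⟦ pairᶜ c d ⟧ X n y = ∃[ a ] ∃[ b ] ⟦ c ⟧ X n a × ⟦ d ⟧ X n b × y ≡ ⟪ a , b ⟫
⟦ compᶜ c d ⟧ X n y = ∃[ z ] ⟦ d ⟧ X n z × ⟦ c ⟧ X z y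
⟦ precᶜ c d ⟧ X n y = primRec (⟦ c ⟧ X) (⟦ d ⟧ X) (left n) (right n) y
⟦ μᶜ c      ⟧ X n y = minimize (⟦ c ⟧ X) n y

Functional : Graph → Set
Functional F = ∀ n {y z} → F n y → F n z → y ≡ z

primRec-functional : ∀ {F G} → Functional F → Functional G → ∀ a → Functional (primRec F G a)
primRec-functional f g a zero    p q = f a p q
primRec-functional f g a (suc k) (_ , p , p′) (_ , q , q′)
  with refl ← primRec-functional f g a k p q = g _ p′ q′

minimize-functional : ∀ {F} → Functional F → Functional (minimize F)
minimize-functional f n {y} {z} (p , p<) (q , q<) with <-cmp y z
... | tri≈ _ y≡z _ = y≡z
... | tri< y<z _ _ = contradiction (f ⟪ n , y ⟫ p (proj₂ (q< y y<z))) λ ()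
... | tri> _ _ z<y = contradiction (f ⟪ n , z ⟫ q (proj₂ (p< z z<y))) λ ()

⟦⟧-functional : ∀ c X → Functional (⟦ c ⟧ X)
⟦⟧-functional zeroᶜ   X n refl refl = refl
⟦⟧-functional succᶜ   X n refl refl = refl
⟦⟧-functional leftᶜ   X n refl refl = refl
⟦⟧-functional rightᶜ  X n refl refl = refl
⟦⟧-functional oracleᶜ X n (inj₁ (_ , refl)) (inj₁ (_ , refl)) = refl
⟦⟧-functional oracleᶜ X n (inj₁ (x , _)) (inj₂ (¬x , _)) = contradiction x ¬x
⟦⟧-functional oracleᶜ X n (inj₂ (¬x , _)) (inj₁ (x , _)) = contradiction x ¬x
⟦⟧-functional oracleᶜ X n (inj₂ (_ , refl)) (inj₂ (_ , refl)) = refl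
⟦⟧-functional (pairᶜ c d) X n (_ , _ , p , p′ , refl) (_ , _ , q , q′ , refl) =
  cong₂ ⟪_,_⟫ (⟦⟧-functional c X n p q) (⟦⟧-functional d X n p′ q′)
⟦⟧-functional (compᶜ c d) X n (_ , p , p′) (_ , q , q′)
  with refl ← ⟦⟧-functional d X n p q = ⟦⟧-functional c X _ p′ q′
⟦⟧-functional (precᶜ c d) X n =
  primRec-functional (⟦⟧-functional c X) (⟦⟧-functional d X) (left n) (right n)
⟦⟧-functional (μᶜ c) X = minimize-functional (⟦⟧-functional c X)

------------------------------------------------------------------------
-- Gödel numbering of codes

encode : Code → ℕ
encode zeroᶜ       = ⟪ 0 , 0 ⟫
encode succᶜ       = ⟪ 1 , 0 ⟫
encode leftᶜ       = ⟪ 2 , 0 ⟫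
encode rightᶜ      = ⟪ 3 , 0 ⟫
encode oracleᶜ     = ⟪ 4 , 0 ⟫
encode (pairᶜ c d) = ⟪ 5 , ⟪ encode c , encode d ⟫ ⟫
encode (compᶜ c d) = ⟪ 6 , ⟪ encode c , encode d ⟫ ⟫
encode (precᶜ c d) = ⟪ 7 , ⟪ encode c , encode d ⟫ ⟫
encode (μᶜ c)      = ⟪ 8 , ⟪ encode c , 0 ⟫ ⟫

build : ℕ → Code → Code → Code
build 0 c d = zeroᶜ
build 1 c d = succᶜ
build 2 c d = leftᶜ
build 3 c d = rightᶜ
build 4 c d = oracleᶜ
build 5 c d = pairᶜ c d
build 6 c d = compᶜ c d
build 7 c d = precᶜ c d
build _ c d = μᶜ c

-- The first argument bounds the recursion depth; any bound exceeding e
-- gives the same result.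
decodeWithin : ℕ → ℕ → Code
decodeWithin zero    e = zeroᶜ
decodeWithin (suc k) e =
  build (left e) (decodeWithin k (left (right e))) (decodeWithin k (right (right e)))

decode : ℕ → Code
decode e = decodeWithin (suc e) e

n≤triangle : ∀ n → n ≤ triangle n
n≤triangle zero    = ≤-refl
n≤triangle (suc n) = m≤m+n (suc n) (triangle n)

m≤⟪m,n⟫ : ∀ m n → m ≤ ⟪ m , n ⟫
m≤⟪m,n⟫ m n = ≤-trans (m≤m+n m n) (≤-trans (n≤triangle (m + n)) (m≤n+m _ n))

n≤⟪m,n⟫ : ∀ m n → n ≤ ⟪ m , n ⟫
n≤⟪m,n⟫ m n = m≤m+n n _

n<⟪1+m,n⟫ : ∀ m n → n < ⟪ suc m , n ⟫
n<⟪1+m,n⟫ m n = ≤-trans (s≤s (m≤m+n n _)) (≤-reflexive (sym (+-suc n _)))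

decodeWithin-⟪⟫ : ∀ k t m n → decodeWithin (suc k) ⟪ t , ⟪ m , n ⟫ ⟫ ≡
                  build t (decodeWithin k m) (decodeWithin k n)
decodeWithin-⟪⟫ k t m n
  rewrite unpair-⟪⟫ t ⟪ m , n ⟫ | unpair-⟪⟫ m n = refl

childˡ< : ∀ t m n {k} → ⟪ suc t , ⟪ m , n ⟫ ⟫ ≤ k → m < k
childˡ< t m n e≤k = ≤-<-trans (m≤⟪m,n⟫ m n) (<-≤-trans (n<⟪1+m,n⟫ t ⟪ m , n ⟫) e≤k)

childʳ< : ∀ t m n {k} → ⟪ suc t , ⟪ m , n ⟫ ⟫ ≤ k → n < k
childʳ< t m n e≤k = ≤-<-trans (n≤⟪m,n⟫ m n) (<-≤-trans (n<⟪1+m,n⟫ t ⟪ m , n ⟫) e≤k)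

decodeWithin-encode : ∀ c k → encode c < k → decodeWithin k (encode c) ≡ c
decodeWithin-encode zeroᶜ   (suc k) _ = refl
decodeWithin-encode succᶜ   (suc k) _ = refl
decodeWithin-encode leftᶜ   (suc k) _ = refl
decodeWithin-encode rightᶜ  (suc k) _ = refl
decodeWithin-encode oracleᶜ (suc k) _ = refl
decodeWithin-encode (pairᶜ c d) (suc k) (s≤s e≤k) =
  trans (decodeWithin-⟪⟫ k 5 (encode c) (encode d))
        (cong₂ pairᶜ (decodeWithin-encode c k (childˡ< 4 (encode c) (encode d) e≤k))
                     (decodeWithin-encode d k (childʳ< 4 (encode c) (encode d) e≤k)))
decodeWithin-encode (compᶜ c d) (suc k) (s≤s e≤k) =
  trans (decodeWithin-⟪⟫ k 6 (encode c) (encode d))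
        (cong₂ compᶜ (decodeWithin-encode c k (childˡ< 5 (encode c) (encode d) e≤k))
                     (decodeWithin-encode d k (childʳ< 5 (encode c) (encode d) e≤k)))
decodeWithin-encode (precᶜ c d) (suc k) (s≤s e≤k) =
  trans (decodeWithin-⟪⟫ k 7 (encode c) (encode d))
        (cong₂ precᶜ (decodeWithin-encode c k (childˡ< 6 (encode c) (encode d) e≤k))
                     (decodeWithin-encode d k (childʳ< 6 (encode c) (encode d) e≤k)))
decodeWithin-encode (μᶜ c) (suc k) (s≤s e≤k) =
  trans (decodeWithin-⟪⟫ k 8 (encode c) 0)
        (cong μᶜ (decodeWithin-encode c k (childˡ< 7 (encode c) 0 e≤k)))

-- Hence every code occurs in the list decode 0, decode 1, …
decode-encode : ∀ c → decode (encode c) ≡ c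
decode-encode c = decodeWithin-encode c _ (n<1+n _)

------------------------------------------------------------------------
-- The standard list, c.e. sets, and the jump

-- Φ X e n y : the e-th function partial computable in X has value y at n.
Φ : Pred ℕ 0ℓ → ℕ → Graph
Φ X e = ⟦ decode e ⟧ X

W : Pred ℕ 0ℓ → ℕ → Pred ℕ 0ℓ
W X e n = ∃[ y ] Φ X e n y

J : Pred ℕ 0ℓ → Graph
J X n = Φ X n n

jump : Pred ℕ 0ℓ → Pred ℕ 0ℓ
jump X n = ∃[ y ] J X n y

∅′ : Pred ℕ 0ℓ
∅′ = jump ∅

ComputableIn : Pred ℕ 0ℓ → (ℕ → ℕ) → Set
ComputableIn X f = ∃[ e ] ∀ n → Φ X e n (f n)

ComputableIn₂ : Pred ℕ 0ℓ → (ℕ → ℕ → ℕ) → Set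
ComputableIn₂ X f = ∃[ e ] ∀ m n → Φ X e ⟪ m , n ⟫ (f m n)

Computable : (ℕ → ℕ) → Set
Computable = ComputableIn ∅

------------------------------------------------------------------------
-- Finite cardinalities

HasCardinality : Pred ℕ 0ℓ → ℕ → Set
HasCardinality P k = ∃[ xs ] Unique xs × length xs ≡ k × (∀ n → P n ⇔ n ∈ xs)

CardinalityAtMost : Pred ℕ 0ℓ → ℕ → Set
CardinalityAtMost P b = ∃[ k ] HasCardinality P k × k ≤ b

CardinalityLessThan : Pred ℕ 0ℓ → ℕ → Set
CardinalityLessThan P b = ∃[ k ] HasCardinality P k × k < b

------------------------------------------------------------------------
-- The two reducibilities

infix 4 _≤JT_ _≤BLR_

_≤JT_ : Pred ℕ 0ℓ → Pred ℕ 0ℓ → Set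
X ≤JT Y = ∃[ f ] ∃[ g ] Computable f × Computable g ×
  (∀ n y → J X n y → W Y (f n) y) ×
  (∀ n → CardinalityAtMost (W Y (f n)) (g n))

-- Convergence in the discrete space ℕ.
Limit : (ℕ → ℕ) → ℕ → Set
Limit a l = ∃[ s₀ ] ∀ s → s₀ ≤ s → a s ≡ l

Changes : (ℕ → ℕ) → Pred ℕ 0ℓ
Changes a s = a s ≢ a (suc s)

BLR : Pred ℕ 0ℓ → Pred (ℕ → ℕ) 0ℓ
BLR A f = ∃[ f̃ ] ∃[ g ] ComputableIn₂ A f̃ × Computable g ×
  (∀ n → Limit (f̃ n) (f n) × CardinalityLessThan (Changes (f̃ n)) (g n))

_≤BLR_ : Pred ℕ 0ℓ → Pred ℕ 0ℓ → Set
X ≤BLR Y = BLR X ⊆ BLR Y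

{-# OPTIONS --safe #-}
module Submission where

-- If BLR(∅′) ⊆ BLR(B), apply this to n ↦ 1 + J^∅′(n) (0 where undefined), whose
-- ∅′-approximation by running time changes at most once: the values taken by
-- its B-approximation trace the jump of ∅′.
--
-- Conversely, let φ = lim f̃ with f̃ computable in ∅′ and changing fewer than γ
-- times, and let f̃ n s = lim h ⟪ n , s ⟫ with h computable. For each i < γ n the
-- jump of ∅′ finds a pair (s , t) such that f̃ n has changed i times before s and
-- h ⟪ n , s ⟫ is constant from t on. A trace computable from B contains these
-- pairs among boundedly many others. A pair is discarded when h is seen to move
-- after t, so a pair that is never discarded gives the true f̃ n s; one of them
-- has s beyond the last change, hence so does the undiscarded pair with the
-- largest s. Following h along that pair approximates φ, with at most two
-- changes per pair: one when it enters and one when it leaves.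

open import Defs
open import Axiom.ExcludedMiddle using (ExcludedMiddle)
open import Data.List using (List; []; _∷_; _++_; length; map; filter; deduplicate)
open import Data.List.Membership.Propositional using (_∈_)
open import Data.List.Membership.Propositional.Properties
open import Data.List.Properties using (length-map; length-++; length-filter; length-deduplicate; filter-notAll)
open import Data.List.Relation.Unary.Any as Any using (here; there)
import Data.List.Relation.Unary.Unique.Propositional.Properties as Unique
open import Data.Nat
open import Data.Nat.Properties
open import Data.List.Relation.Unary.Unique.DecPropositional.Properties _≟_ using (deduplicate-!)
open import Data.Product using (_×_; _,_; proj₁; proj₂; ∃-syntax)
open import Data.Sum using (_⊎_; inj₁; inj₂)
open import Function using (_⇔_; mk⇔; id; _∘_; Equivalence)
open import Level using (0ℓ)
open import Relation.Binary using (tri<; tri≈; tri>)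
open import Relation.Binary.Construct.Closure.ReflexiveTransitive using (Star; ε; _◅_; _◅◅_)
open import Relation.Binary.PropositionalEquality hiding (J)
open import Relation.Nullary using (¬_; ¬?; Dec; contradiction; yes; no)
open import Relation.Nullary.Decidable using (decidable-stable)
open import Relation.Unary using (Pred; ∅)

left-⟪⟫ : ∀ m n → left ⟪ m , n ⟫ ≡ m
left-⟪⟫ m n = cong proj₁ (unpair-⟪⟫ m n)

right-⟪⟫ : ∀ m n → right ⟪ m , n ⟫ ≡ n
right-⟪⟫ m n = cong proj₂ (unpair-⟪⟫ m n)

-- Total functions computable in an oracle

record Algorithm (X : Pred ℕ 0ℓ) (f : ℕ → ℕ) : Set where
  constructor _computes_
  field
    code    : Code
    correct : ∀ n → ⟦ code ⟧ X n (f n)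

open Algorithm

-- Functions of several arguments are handled as families of unary ones: the
-- closure lemmas below are relative to a context x, and an operator binding a
-- variable i takes a body in the context ⟪ x , i ⟫.
Algorithm₂ : Pred ℕ 0ℓ → (ℕ → ℕ → ℕ) → Set
Algorithm₂ X f = Algorithm X λ p → f (left p) (right p)

private variable
  X : Pred ℕ 0ℓ
  f g h : ℕ → ℕ

extₐ : (∀ x → f x ≡ g x) → Algorithm X f → Algorithm X g
extₐ {X = X} f≗g (c computes p) = c computes λ x → subst (⟦ c ⟧ X x) (f≗g x) (p x)

fromComputable : ComputableIn X f → Algorithm X f
fromComputable (e , p) = decode e computes p

toComputable : Algorithm X f → ComputableIn X f
toComputable {X} {f} (c computes p) =
  encode c , λ n → subst (λ d → ⟦ d ⟧ X n (f n)) (sym (decode-encode c)) (p n)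

fromComputable₂ : {f : ℕ → ℕ → ℕ} → ComputableIn₂ X f → Algorithm₂ X f
fromComputable₂ {X} {f} (e , p) = decode e computes λ q →
  subst (λ r → Φ X e r (f (left q) (right q))) (⟪left,right⟫ q) (p (left q) (right q))

toComputable₂ : {f : ℕ → ℕ → ℕ} → Algorithm₂ X f → ComputableIn₂ X f
toComputable₂ {X} {f} a with e , p ← toComputable a = e , λ m n →
  subst (Φ X e ⟪ m , n ⟫) (cong₂ f (left-⟪⟫ m n) (right-⟪⟫ m n)) (p ⟪ m , n ⟫)

infixr 9 _∘ₐ_

_∘ₐ_ : Algorithm X f → Algorithm X g → Algorithm X (f ∘ g)
(c computes p) ∘ₐ (d computes q) = compᶜ c d computes λ x → _ , q x , p _

leftₐ : Algorithm X f → Algorithm X (left ∘ f)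
leftₐ a = (leftᶜ computes λ _ → refl) ∘ₐ a

rightₐ : Algorithm X f → Algorithm X (right ∘ f)
rightₐ a = (rightᶜ computes λ _ → refl) ∘ₐ a

sucₐ : Algorithm X f → Algorithm X (suc ∘ f)
sucₐ a = (succᶜ computes λ _ → refl) ∘ₐ a

⟪_,_⟫ₐ : Algorithm X f → Algorithm X g → Algorithm X (λ x → ⟪ f x , g x ⟫)
⟪ c computes p , d computes q ⟫ₐ = pairᶜ c d computes λ x → _ , _ , p x , q x , refl

idᶜ : Code
idᶜ = pairᶜ leftᶜ rightᶜ

idₐ : Algorithm X id
idₐ = idᶜ computes λ x → _ , _ , refl , refl , sym (⟪left,right⟫ x)

constᶜ : ℕ → Code
constᶜ zero    = zeroᶜ
constᶜ (suc k) = compᶜ succᶜ (constᶜ k)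

constᶜ-correct : ∀ k x → ⟦ constᶜ k ⟧ X x k
constᶜ-correct zero    x = refl
constᶜ-correct (suc k) x = k , constᶜ-correct k x , refl

constₐ : ∀ k → Algorithm X λ _ → k
constₐ k = constᶜ k computes constᶜ-correct k

app₂ : (f : ℕ → ℕ → ℕ) → Algorithm₂ X f → Algorithm X g → Algorithm X h → Algorithm X λ x → f (g x) (h x)
app₂ {g = g} {h = h} f a b c =
  extₐ (λ x → cong₂ f (left-⟪⟫ (g x) (h x)) (right-⟪⟫ (g x) (h x))) (a ∘ₐ ⟪ b , c ⟫ₐ)

outer : Algorithm X f → Algorithm X (f ∘ left)
outer a = a ∘ₐ leftₐ idₐ

inner : Algorithm X right
inner = rightₐ idₐ

natRec : ℕ → (ℕ → ℕ → ℕ) → ℕ → ℕ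
natRec b s zero    = b
natRec b s (suc k) = s k (natRec b s k)

natRecₐ : ∀ {b k : ℕ → ℕ} (s : ℕ → ℕ → ℕ → ℕ) → Algorithm X b →
          Algorithm X (λ p → s (left p) (left (right p)) (right (right p))) →
          Algorithm X k → Algorithm X λ x → natRec (b x) (s x) (k x)
natRecₐ {X = X} {b = b} s (cb computes pb) (cs computes ps) ak =
  app₂ (λ x k → natRec (b x) (s x) k) (precᶜ cb cs computes λ p → go (left p) (right p)) idₐ ak
  where
  go : ∀ x k → primRec (⟦ cb ⟧ X) (⟦ cs ⟧ X) x k (natRec (b x) (s x) k)
  go x zero    = pb x
  go x (suc k) = z , go x k , subst (⟦ cs ⟧ X ⟪ x , ⟪ k , z ⟫ ⟫) unpaired (ps ⟪ x , ⟪ k , z ⟫ ⟫)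
    where
    z = natRec (b x) (s x) k
    unpaired : s (left ⟪ x , ⟪ k , z ⟫ ⟫) (left (right ⟪ x , ⟪ k , z ⟫ ⟫)) (right (right ⟪ x , ⟪ k , z ⟫ ⟫))
               ≡ s x k z
    unpaired = trans
      (cong₂ (λ l r → s l (left r) (right r)) (left-⟪⟫ x ⟪ k , z ⟫) (right-⟪⟫ x ⟪ k , z ⟫))
      (cong₂ (s x) (left-⟪⟫ k z) (right-⟪⟫ k z))

-- Arithmetic

ifZero : ℕ → ℕ → ℕ → ℕ
ifZero zero    a b = a
ifZero (suc _) a b = b

ifZeroₐ : Algorithm X h → Algorithm X f → Algorithm X g →
          Algorithm X λ x → ifZero (h x) (f x) (g x)
ifZeroₐ {h = h} {f = f} {g = g} c a b =
  extₐ (λ x → lem (f x) (g x) (h x)) (natRecₐ (λ x _ _ → g x) a (outer b) c)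
  where
  lem : ∀ a b n → natRec a (λ _ _ → b) n ≡ ifZero n a b
  lem a b zero    = refl
  lem a b (suc n) = refl

predₐ : Algorithm X f → Algorithm X (pred ∘ f)
predₐ {f = f} a = extₐ (λ x → lem (f x)) (natRecₐ (λ _ k _ → k) (constₐ 0) (leftₐ inner) a)
  where
  lem : ∀ n → natRec 0 (λ k _ → k) n ≡ pred n
  lem zero    = refl
  lem (suc n) = refl

_+ₐ_ : Algorithm X f → Algorithm X g → Algorithm X λ x → f x + g x
_+ₐ_ {f = f} {g} a b =
  extₐ (λ x → lem (f x) (g x)) (natRecₐ (λ _ _ z → suc z) a (sucₐ (rightₐ inner)) b)
  where
  lem : ∀ m n → natRec m (λ _ z → suc z) n ≡ m + n
  lem m zero    = sym (+-identityʳ m)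
  lem m (suc n) = trans (cong suc (lem m n)) (sym (+-suc m n))

_∸ₐ_ : Algorithm X f → Algorithm X g → Algorithm X λ x → f x ∸ g x
_∸ₐ_ {f = f} {g} a b =
  extₐ (λ x → lem (f x) (g x)) (natRecₐ (λ _ _ z → pred z) a (predₐ (rightₐ inner)) b)
  where
  lem : ∀ m n → natRec m (λ _ z → pred z) n ≡ m ∸ n
  lem m zero    = refl
  lem m (suc n) = trans (cong pred (lem m n)) (pred[m∸n]≡m∸[1+n] m n)

∣_-_∣ₐ : Algorithm X f → Algorithm X g → Algorithm X λ x → ∣ f x - g x ∣
∣_-_∣ₐ {f = f} {g} a b = extₐ (λ x → lem (f x) (g x)) ((a ∸ₐ b) +ₐ (b ∸ₐ a))
  where
  lem : ∀ m n → (m ∸ n) + (n ∸ m) ≡ ∣ m - n ∣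
  lem zero    n       = cong (_+ n) (0∸n≡0 n)
  lem (suc m) zero    = cong suc (+-identityʳ m)
  lem (suc m) (suc n) = lem m n

_⊔ₐ_ : Algorithm X f → Algorithm X g → Algorithm X λ x → f x ⊔ g x
_⊔ₐ_ {f = f} {g} a b = extₐ (λ x → lem (f x) (g x)) (a +ₐ (b ∸ₐ a))
  where
  lem : ∀ m n → m + (n ∸ m) ≡ m ⊔ n
  lem zero    n       = refl
  lem (suc m) zero    = cong suc (+-identityʳ m)
  lem (suc m) (suc n) = cong suc (lem m n)

sumBelow maxBelow : (ℕ → ℕ) → ℕ → ℕ
sumBelow q = natRec 0 λ i z → q i + z
maxBelow q = natRec 0 λ i z → q i ⊔ z

private
  bodyₐ : {q : ℕ → ℕ → ℕ} → Algorithm₂ X q → Algorithm X λ p → q (left p) (left (right p))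
  bodyₐ {q = q} a = app₂ q a (leftₐ idₐ) (leftₐ inner)

sumBelowₐ : (q : ℕ → ℕ → ℕ) → Algorithm₂ X q → Algorithm X f → Algorithm X λ x → sumBelow (q x) (f x)
sumBelowₐ q a k = natRecₐ (λ x i z → q x i + z) (constₐ 0) (bodyₐ {q = q} a +ₐ rightₐ inner) k

maxBelowₐ : (q : ℕ → ℕ → ℕ) → Algorithm₂ X q → Algorithm X f → Algorithm X λ x → maxBelow (q x) (f x)
maxBelowₐ q a k = natRecₐ (λ x i z → q x i ⊔ z) (constₐ 0) (bodyₐ {q = q} a ⊔ₐ rightₐ inner) k

maxBelow-upper : ∀ (q : ℕ → ℕ) k {i} → i < k → q i ≤ maxBelow q k
maxBelow-upper q (suc k) {i} (s≤s i≤k) with m≤n⇒m<n∨m≡n i≤k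
... | inj₁ i<k  = ≤-trans (maxBelow-upper q k i<k) (m≤n⊔m (q k) _)
... | inj₂ refl = m≤m⊔n (q k) _

maxBelow-attained : ∀ (q : ℕ → ℕ) k {v} → maxBelow q k ≡ suc v → ∃[ i ] i < k × q i ≡ suc v
maxBelow-attained q (suc k) eq with ⊔-sel (q k) (maxBelow q k)
... | inj₁ eq′ = k , ≤-refl , trans (sym eq′) eq
... | inj₂ eq′ with i , i<k , p ← maxBelow-attained q k (trans (sym eq′) eq) = i , m<n⇒m<1+n i<k , p

-- Moving oracle-free algorithms to another oracle

primRec-⊆ : ∀ {F F′ G G′} → (∀ {n y} → F n y → F′ n y) → (∀ {n y} → G n y → G′ n y) →
            ∀ a k {y} → primRec F G a k y → primRec F′ G′ a k y
primRec-⊆ F⊆ G⊆ a zero    p           = F⊆ p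
primRec-⊆ F⊆ G⊆ a (suc k) (z , p , q) = z , primRec-⊆ F⊆ G⊆ a k p , G⊆ q

withoutOracle : Code → Code
withoutOracle oracleᶜ     = zeroᶜ
withoutOracle (pairᶜ c d) = pairᶜ (withoutOracle c) (withoutOracle d)
withoutOracle (compᶜ c d) = compᶜ (withoutOracle c) (withoutOracle d)
withoutOracle (precᶜ c d) = precᶜ (withoutOracle c) (withoutOracle d)
withoutOracle (μᶜ c)      = μᶜ (withoutOracle c)
withoutOracle c           = c

-- Over `∅` every query is answered 0, which is what `zeroᶜ` returns over any `X`.
withoutOracle-correct : ∀ c {n y} → ⟦ c ⟧ ∅ n y → ⟦ withoutOracle c ⟧ X n y
withoutOracle-correct zeroᶜ   p = p
withoutOracle-correct succᶜ   p = p
withoutOracle-correct leftᶜ   p = p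
withoutOracle-correct rightᶜ  p = p
withoutOracle-correct oracleᶜ (inj₂ (_ , p)) = p
withoutOracle-correct (pairᶜ c d) (a , b , p , q , r) =
  a , b , withoutOracle-correct c p , withoutOracle-correct d q , r
withoutOracle-correct (compᶜ c d) (z , p , q) =
  z , withoutOracle-correct d p , withoutOracle-correct c q
withoutOracle-correct (precᶜ c d) {n} p =
  primRec-⊆ (withoutOracle-correct c) (withoutOracle-correct d) (left n) (right n) p
withoutOracle-correct (μᶜ c) (p , q) = withoutOracle-correct c p ,
  λ i i<y → let v , r = q i i<y in v , withoutOracle-correct c r

relativise : Algorithm ∅ f → Algorithm X f
relativise (c computes p) = withoutOracle c computes λ n → withoutOracle-correct c (p n)

-- Unbounded search and the s-m-n theorem

-- For a total test these are exactly the two conditions in `minimize`.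
least : ∀ (t : ℕ → ℕ) k → t k ≡ 0 → ∃[ v ] t v ≡ 0 × (∀ i → i < v → ∃[ w ] t i ≡ suc w)
least t zero    eq = 0 , eq , λ _ ()
least t (suc k) eq with t 0 in t0
... | zero  = 0 , t0 , λ _ ()
... | suc w with v , p , q ← least (t ∘ suc) k eq = suc v , p , below
  where
  below : ∀ i → i < suc v → ∃[ w ] t i ≡ suc w
  below zero    _         = w , t0
  below (suc i) (s≤s i<v) = q i i<v

μᶜ-sound : (a : Algorithm X f) → ∀ {x v} → ⟦ μᶜ (code a) ⟧ X x v → f ⟪ x , v ⟫ ≡ 0
μᶜ-sound {X} (c computes p) (q , _) = ⟦⟧-functional c X _ (p _) q

μᶜ-complete : (a : Algorithm X f) → ∀ {x k} → f ⟪ x , k ⟫ ≡ 0 → ∃[ v ] ⟦ μᶜ (code a) ⟧ X x v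
μᶜ-complete {X} {f} (c computes p) {x} {k} eq
  with v , q , r ← least (λ i → f ⟪ x , i ⟫) k eq =
  v , subst (⟦ c ⟧ X ⟪ x , v ⟫) q (p ⟪ x , v ⟫) ,
  λ i i<v → let w , s = r i i<v in w , subst (⟦ c ⟧ X ⟪ x , i ⟫) s (p ⟪ x , i ⟫)

Φ-encode : ∀ c e → e ≡ encode c → ∀ {n y} → Φ X e n y → ⟦ c ⟧ X n y
Φ-encode {X} c e refl {n} {y} = subst (λ d → ⟦ d ⟧ X n y) (decode-encode c)

encode-Φ : ∀ c e → e ≡ encode c → ∀ {n y} → ⟦ c ⟧ X n y → Φ X e n y
encode-Φ {X} c e refl {n} {y} = subst (λ d → ⟦ d ⟧ X n y) (sym (decode-encode c))

specialise : Code → ℕ → Code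
specialise c x = compᶜ c (pairᶜ (constᶜ x) idᶜ)

specialise-sound : ∀ c x {y v} → ⟦ specialise c x ⟧ X y v → ⟦ c ⟧ X ⟪ x , y ⟫ v
specialise-sound {X} c x {y} {v} (_ , (a , _ , q , (_ , _ , refl , refl , refl) , refl) , r) =
  subst₂ (λ a b → ⟦ c ⟧ X ⟪ a , b ⟫ v)
    (⟦⟧-functional (constᶜ x) X y q (constᶜ-correct x y)) (⟪left,right⟫ y) r

specialise-complete : ∀ c x {y v} → ⟦ c ⟧ X ⟪ x , y ⟫ v → ⟦ specialise c x ⟧ X y v
specialise-complete {X} c x {y} p =
  ⟪ x , y ⟫ , (x , y , constᶜ-correct x y , correct (idₐ {X}) y , refl) , p

-- Opacity keeps the type checker from evaluating Gödel numbers.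
opaque
  index : Code → ℕ → ℕ
  index c x = encode (specialise c x)

  index-spec : ∀ c x → index c x ≡ encode (specialise c x)
  index-spec c x = refl

  indexₐ : ∀ c → Algorithm X (index c)
  indexₐ {X} c = encodedₐ c idᶜ
    where
    constₐ# : Algorithm X (encode ∘ constᶜ)
    constₐ# = extₐ lem
      -- 6 is the tag of `compᶜ` and 1 is `encode succᶜ`, so each round passes from `constᶜ k` to
      -- `constᶜ (suc k)`; the initial 0 is `encode zeroᶜ`.
      (natRecₐ (λ _ _ z → ⟪ 6 , ⟪ 1 , z ⟫ ⟫) (constₐ 0)
        ⟪ constₐ 6 , ⟪ constₐ 1 , rightₐ inner ⟫ₐ ⟫ₐ idₐ)
      where
      lem : ∀ k → natRec 0 (λ _ z → ⟪ 6 , ⟪ 1 , z ⟫ ⟫) k ≡ encode (constᶜ k)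
      lem zero    = refl
      lem (suc k) = cong (λ z → ⟪ 6 , ⟪ 1 , z ⟫ ⟫) (lem k)
    encodedₐ : ∀ c d → Algorithm X λ x → encode (compᶜ c (pairᶜ (constᶜ x) d))
    encodedₐ c d =
      ⟪ constₐ 6 , ⟪ constₐ (encode c) , ⟪ constₐ 5 , ⟪ constₐ# , constₐ (encode d) ⟫ₐ ⟫ₐ ⟫ₐ ⟫ₐ

index-sound : ∀ c x {y v} → Φ X (index c x) y v → ⟦ c ⟧ X ⟪ x , y ⟫ v
index-sound c x p = specialise-sound c x (Φ-encode (specialise c x) (index c x) (index-spec c x) p)

index-complete : ∀ c x {y v} → ⟦ c ⟧ X ⟪ x , y ⟫ v → Φ X (index c x) y v
index-complete c x p =
  encode-Φ (specialise c x) (index c x) (index-spec c x) (specialise-complete c x p)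

private
  unpair³ : (t : ℕ → ℕ → ℕ → ℕ) → ∀ x y v →
            t (left (left ⟪ ⟪ x , y ⟫ , v ⟫)) (right (left ⟪ ⟪ x , y ⟫ , v ⟫)) (right ⟪ ⟪ x , y ⟫ , v ⟫)
            ≡ t x y v
  unpair³ t x y v = trans
    (cong₂ (λ l r → t (left l) (right l) r) (left-⟪⟫ ⟪ x , y ⟫ v) (right-⟪⟫ ⟪ x , y ⟫ v))
    (cong₂ (λ a b → t a b v) (left-⟪⟫ x y) (right-⟪⟫ x y))

-- An s-m-n index for the search of a zero of `t x y`: `W X (program x)` consists of the `y` having
-- a zero, and the value returned is a zero itself. `complete` returns a new `v′` because the search
-- may stop earlier. The indices are computable without oracle although `t` may consult `X`.
record SearchIndex (X : Pred ℕ 0ℓ) (t : ℕ → ℕ → ℕ → ℕ) : Set where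
  field
    program  : ℕ → ℕ
    programₐ : Algorithm ∅ program
    sound    : ∀ x {y v} → Φ X (program x) y v → t x y v ≡ 0
    complete : ∀ x {y v} → t x y v ≡ 0 → ∃[ v′ ] Φ X (program x) y v′

opaque
  searchIndex : (t : ℕ → ℕ → ℕ → ℕ) →
                Algorithm X (λ p → t (left (left p)) (right (left p)) (right p)) →
                SearchIndex X t
  searchIndex t a = record
    { program  = index c
    ; programₐ = indexₐ c
    ; sound    = λ x {y} {v} p → trans (sym (unpair³ t x y v))
        (μᶜ-sound a {⟪ x , y ⟫} (index-sound c x p))
    ; complete = λ x {y} {v} eq →
        let v′ , p = μᶜ-complete a {⟪ x , y ⟫} {v} (trans (unpair³ t x y v) eq) in
        v′ , index-complete c x p
    }
    where
    c : Code
    c = μᶜ (code a)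

-- A universal stack machine

-- A state is an accumulator v with a stack k of frames, 0 being the empty stack:
--   evalF e          run the program e on v
--   pairThenF d n    v is a first component; run d on n for the second
--   pairWithF a      return ⟪ a , v ⟫
--   recurF d a j r   v is the j-th value of a recursion with parameter a; r steps are left
--   searchF c n i    v is the value of c at ⟪ n , i ⟫ in a search for a zero
-- Opacity makes the type checker compare states without computing pairs.
opaque
  state : ℕ → ℕ → ℕ
  state v k = ⟪ v , k ⟫

  frame : ℕ → ℕ → ℕ → ℕ
  frame t x k = suc ⟪ ⟪ t , x ⟫ , k ⟫

  evalF pairWithF : ℕ → ℕ → ℕ
  evalF     = frame 0
  pairWithF = frame 2

  pairThenF : ℕ → ℕ → ℕ → ℕ
  pairThenF d n = frame 1 ⟪ d , n ⟫

  recurF : ℕ → ℕ → ℕ → ℕ → ℕ → ℕ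
  recurF d a j r = frame 3 ⟪ ⟪ d , a ⟫ , ⟪ j , r ⟫ ⟫

  searchF : ℕ → ℕ → ℕ → ℕ → ℕ
  searchF c n i = frame 4 ⟪ c , ⟪ n , i ⟫ ⟫

-- The argument b is the oracle's answer to the accumulator v.
evalStep : ℕ → ℕ → ℕ → ℕ → ℕ → ℕ → ℕ
evalStep b v t c d k =
  ifZero t                             (state 0 k) (
  ifZero (t ∸ 1)                       (state (suc v) k) (
  ifZero (t ∸ 2)                       (state (left v) k) (
  ifZero (t ∸ 3)                       (state (right v) k) (
  ifZero (t ∸ 4)                       (state b k) (
  ifZero (t ∸ 5)                       (state v (evalF c (pairThenF d v k))) (
  ifZero (t ∸ 6)                       (state v (evalF d (evalF c k))) (
  ifZero (t ∸ 7)                       (state (left v) (evalF c (recurF d (left v) 0 (right v) k)))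
    (state ⟪ v , 0 ⟫ (evalF c (searchF c v 0 k))))))))))

recurStep : ℕ → ℕ → ℕ → ℕ → ℕ → ℕ → ℕ
recurStep v d a j r k =
  ifZero r (state v k)
    (state ⟪ a , ⟪ j , v ⟫ ⟫ (evalF d (recurF d a (suc j) (pred r) k)))

searchStep : ℕ → ℕ → ℕ → ℕ → ℕ → ℕ
searchStep v c n i k =
  ifZero v (state i k) (state ⟪ n , suc i ⟫ (evalF c (searchF c n (suc i) k)))

-- Smaller tags being excluded first, `t ∸ i` vanishes only for `t ≡ i`; the last branch takes all
-- remaining tags.
frameStep : ℕ → ℕ → ℕ → ℕ → ℕ → ℕ
frameStep b v t x k =
  ifZero t       (evalStep b v (left x) (left (right x)) (right (right x)) k) (
  ifZero (t ∸ 1) (state (right x) (evalF (left x) (pairWithF v k))) (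
  ifZero (t ∸ 2) (state ⟪ x , v ⟫ k) (
  ifZero (t ∸ 3) (recurStep v (left (left x)) (right (left x)) (left (right x)) (right (right x)) k)
    (searchStep v (left x) (left (right x)) (right (right x)) k))))

stackStep : ℕ → ℕ → ℕ → ℕ
stackStep b v k = ifZero k (state v k)
  (frameStep b v (left (left (pred k))) (right (left (pred k))) (right (pred k)))

opaque
  unfolding state

  step : ℕ → ℕ → ℕ
  step b s = stackStep b (left s) (right s)

-- The oracle is an arbitrary function, so that finite stages of an approximation to `∅′` can take
-- its place. It is consulted at the accumulator in every step, whether or not the answer is used.
run : (ℕ → ℕ) → ℕ → ℕ → ℕ
run o st = natRec st λ _ s → step (o (left s)) s

private opaque
  unfolding step

  frameₐ : ∀ {t x k} → Algorithm X t → Algorithm X x → Algorithm X k →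
           Algorithm X λ i → frame (t i) (x i) (k i)
  frameₐ t x k = sucₐ ⟪ ⟪ t , x ⟫ₐ , k ⟫ₐ

  evalFₐ : ∀ {x k} → Algorithm X x → Algorithm X k → Algorithm X λ i → evalF (x i) (k i)
  evalFₐ = frameₐ (constₐ 0)

  recurFₐ : ∀ {d a j r k} → Algorithm X d → Algorithm X a → Algorithm X j → Algorithm X r →
            Algorithm X k → Algorithm X λ i → recurF (d i) (a i) (j i) (r i) (k i)
  recurFₐ d a j r = frameₐ (constₐ 3) ⟪ ⟪ d , a ⟫ₐ , ⟪ j , r ⟫ₐ ⟫ₐ

  searchFₐ : ∀ {c n i k} → Algorithm X c → Algorithm X n → Algorithm X i → Algorithm X k →
             Algorithm X λ x → searchF (c x) (n x) (i x) (k x)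
  searchFₐ c n i = frameₐ (constₐ 4) ⟪ c , ⟪ n , i ⟫ₐ ⟫ₐ

  evalStepₐ : ∀ {b v t c d k} → Algorithm X b → Algorithm X v → Algorithm X t → Algorithm X c →
              Algorithm X d → Algorithm X k →
              Algorithm X λ i → evalStep (b i) (v i) (t i) (c i) (d i) (k i)
  evalStepₐ b v t c d k =
    ifZeroₐ t                 ⟪ constₐ 0 , k ⟫ₐ (
    ifZeroₐ (t ∸ₐ constₐ 1) ⟪ sucₐ v , k ⟫ₐ (
    ifZeroₐ (t ∸ₐ constₐ 2) ⟪ leftₐ v , k ⟫ₐ (
    ifZeroₐ (t ∸ₐ constₐ 3) ⟪ rightₐ v , k ⟫ₐ (
    ifZeroₐ (t ∸ₐ constₐ 4) ⟪ b , k ⟫ₐ (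
    ifZeroₐ (t ∸ₐ constₐ 5) ⟪ v , evalFₐ c (frameₐ (constₐ 1) ⟪ d , v ⟫ₐ k) ⟫ₐ (
    ifZeroₐ (t ∸ₐ constₐ 6) ⟪ v , evalFₐ d (evalFₐ c k) ⟫ₐ (
    ifZeroₐ (t ∸ₐ constₐ 7) ⟪ leftₐ v , evalFₐ c (recurFₐ d (leftₐ v) (constₐ 0) (rightₐ v) k) ⟫ₐ
      ⟪ ⟪ v , constₐ 0 ⟫ₐ , evalFₐ c (searchFₐ c v (constₐ 0) k) ⟫ₐ)))))))

  recurStepₐ : ∀ {v d a j r k} → Algorithm X v → Algorithm X d → Algorithm X a → Algorithm X j →
               Algorithm X r → Algorithm X k →
               Algorithm X λ i → recurStep (v i) (d i) (a i) (j i) (r i) (k i)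
  recurStepₐ v d a j r k = ifZeroₐ r ⟪ v , k ⟫ₐ
    ⟪ ⟪ a , ⟪ j , v ⟫ₐ ⟫ₐ , evalFₐ d (recurFₐ d a (sucₐ j) (predₐ r) k) ⟫ₐ

  searchStepₐ : ∀ {v c n i k} → Algorithm X v → Algorithm X c → Algorithm X n → Algorithm X i →
                Algorithm X k → Algorithm X λ x → searchStep (v x) (c x) (n x) (i x) (k x)
  searchStepₐ v c n i k = ifZeroₐ v ⟪ i , k ⟫ₐ
    ⟪ ⟪ n , sucₐ i ⟫ₐ , evalFₐ c (searchFₐ c n (sucₐ i) k) ⟫ₐ

  frameStepₐ : ∀ {b v t x k} → Algorithm X b → Algorithm X v → Algorithm X t → Algorithm X x →
               Algorithm X k → Algorithm X λ i → frameStep (b i) (v i) (t i) (x i) (k i)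
  frameStepₐ b v t x k =
    ifZeroₐ t                 (evalStepₐ b v (leftₐ x) (leftₐ (rightₐ x)) (rightₐ (rightₐ x)) k) (
    ifZeroₐ (t ∸ₐ constₐ 1) ⟪ rightₐ x , evalFₐ (leftₐ x) (frameₐ (constₐ 2) v k) ⟫ₐ (
    ifZeroₐ (t ∸ₐ constₐ 2) ⟪ ⟪ x , v ⟫ₐ , k ⟫ₐ (
    ifZeroₐ (t ∸ₐ constₐ 3)
      (recurStepₐ v (leftₐ (leftₐ x)) (rightₐ (leftₐ x)) (leftₐ (rightₐ x)) (rightₐ (rightₐ x)) k)
      (searchStepₐ v (leftₐ x) (leftₐ (rightₐ x)) (rightₐ (rightₐ x)) k))))

  stepₐ : ∀ {b s} → Algorithm X b → Algorithm X s → Algorithm X λ i → step (b i) (s i)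
  stepₐ b s = let k = predₐ (rightₐ s) in
    ifZeroₐ (rightₐ s) ⟪ leftₐ s , rightₐ s ⟫ₐ
      (frameStepₐ b (leftₐ s) (leftₐ (leftₐ k)) (rightₐ (leftₐ k)) (rightₐ k))

runₐ : ∀ {st k : ℕ → ℕ} (o : ℕ → ℕ → ℕ) → Algorithm₂ X o → Algorithm X st → Algorithm X k →
       Algorithm X λ x → run (o x) (st x) (k x)
runₐ o oₐ st k = natRecₐ (λ x _ s → step (o x (left s)) s) st
  (stepₐ (app₂ o oₐ (leftₐ idₐ) (leftₐ (rightₐ inner))) (rightₐ inner)) k

opaque
  unfolding state

  result : ℕ → ℕ
  result st = ifZero (right st) (suc (left st)) 0

  result-halted : ∀ y → result (state y 0) ≡ suc y
  result-halted y = cong₂ (λ k v → ifZero k (suc v) 0) (right-⟪⟫ y 0) (left-⟪⟫ y 0)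

  halted-result : ∀ {st y} → result st ≡ suc y → st ≡ state y 0
  halted-result {st} eq with right st in r
  halted-result {st} refl | zero = trans (sym (⟪left,right⟫ st)) (cong ⟪ left st ,_⟫ r)

-- 0 while the computation is running, suc y once it has halted with value y
evalWithin : (ℕ → ℕ) → ℕ → ℕ → ℕ → ℕ
evalWithin o e n s = result (run o (state n (evalF e 0)) s)

opaque
  unfolding result state

  evalWithinₐ : ∀ {e n s : ℕ → ℕ} (o : ℕ → ℕ → ℕ) → Algorithm₂ X o →
                Algorithm X e → Algorithm X n → Algorithm X s →
                Algorithm X λ x → evalWithin (o x) (e x) (n x) (s x)
  evalWithinₐ o oₐ e n s =
    let r = runₐ o oₐ ⟪ n , evalFₐ e (constₐ 0) ⟫ₐ s in
    ifZeroₐ (rightₐ r) (sucₐ (leftₐ r)) (constₐ 0)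

below-suc : {P : ℕ → Set} → ∀ {i} → (∀ j → j < i → P j) → P i → ∀ j → j < suc i → P j
below-suc p q j (s≤s j≤i) with m≤n⇒m<n∨m≡n j≤i
... | inj₁ j<i  = p j j<i
... | inj₂ refl = q

module Machine (o : ℕ → ℕ) where

  nextState : ℕ → ℕ
  nextState s = step (o (left s)) s

  opaque
    unfolding step

    step-frame : ∀ b v t x k → step b (state v (frame t x k)) ≡ frameStep b v t x k
    step-frame b v t x k = trans
      (cong₂ (stackStep b) (left-⟪⟫ v (frame t x k)) (right-⟪⟫ v (frame t x k)))
      (trans
        (cong₂ (λ l r → frameStep b v (left l) (right l) r)
          (left-⟪⟫ ⟪ t , x ⟫ k) (right-⟪⟫ ⟪ t , x ⟫ k))
        (cong₂ (λ t x → frameStep b v t x k) (left-⟪⟫ t x) (right-⟪⟫ t x)))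

    next-frame : ∀ v t x k → nextState (state v (frame t x k)) ≡ frameStep (o v) v t x k
    next-frame v t x k = trans
      (cong (λ l → step (o l) (state v (frame t x k))) (left-⟪⟫ v (frame t x k)))
      (step-frame (o v) v t x k)

    next-halted : ∀ v → nextState (state v 0) ≡ state v 0
    next-halted v = cong₂ (stackStep (o (left (state v 0)))) (left-⟪⟫ v 0) (right-⟪⟫ v 0)

    next-pairThen : ∀ v d n k → nextState (state v (pairThenF d n k)) ≡ state n (evalF d (pairWithF v k))
    next-pairThen v d n k = trans (next-frame v 1 ⟪ d , n ⟫ k)
      (cong₂ (λ d n → state n (evalF d (pairWithF v k))) (left-⟪⟫ d n) (right-⟪⟫ d n))

    next-recur : ∀ v d a j r k → nextState (state v (recurF d a j r k)) ≡ recurStep v d a j r k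
    next-recur v d a j r k = trans (next-frame v 3 ⟪ ⟪ d , a ⟫ , ⟪ j , r ⟫ ⟫ k) (trans
      (cong₂ (λ x y → recurStep v (left x) (right x) (left y) (right y) k)
        (left-⟪⟫ ⟪ d , a ⟫ ⟪ j , r ⟫) (right-⟪⟫ ⟪ d , a ⟫ ⟪ j , r ⟫)) (trans
      (cong₂ (λ d a → recurStep v d a (left ⟪ j , r ⟫) (right ⟪ j , r ⟫) k)
        (left-⟪⟫ d a) (right-⟪⟫ d a))
      (cong₂ (λ j r → recurStep v d a j r k) (left-⟪⟫ j r) (right-⟪⟫ j r))))

    next-search : ∀ v c n i k → nextState (state v (searchF c n i k)) ≡ searchStep v c n i k
    next-search v c n i k = trans (next-frame v 4 ⟪ c , ⟪ n , i ⟫ ⟫ k) (trans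
      (cong₂ (λ x y → searchStep v x (left y) (right y) k)
        (left-⟪⟫ c ⟪ n , i ⟫) (right-⟪⟫ c ⟪ n , i ⟫))
      (cong₂ (λ n i → searchStep v c n i k) (left-⟪⟫ n i) (right-⟪⟫ n i)))

    next-eval : ∀ v e k →
                nextState (state v (evalF e k)) ≡ evalStep (o v) v (left e) (left (right e)) (right (right e)) k
    next-eval v = next-frame v 0

    next-pairWith : ∀ v a k → nextState (state v (pairWithF a k)) ≡ state ⟪ a , v ⟫ k
    next-pairWith v = next-frame v 2

    search≢halted : ∀ {w c n i k v} → state w (searchF c n i k) ≢ state v 0
    search≢halted {w} {c} {n} {i} {k} {v} eq = contradiction
      (trans (sym (right-⟪⟫ w (searchF c n i k))) (trans (cong right eq) (right-⟪⟫ v 0))) λ ()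

  infix 3 _⟶*_

  _⟶*_ : ℕ → ℕ → Set
  _⟶*_ = Star λ s s′ → nextState s ≡ s′

  run-suc : ∀ st s → run o st (suc s) ≡ run o (nextState st) s
  run-suc st zero    = refl
  run-suc st (suc s) = cong nextState (run-suc st s)

  Halts : ℕ → ℕ → ℕ → Set
  Halts v st s = run o st s ≡ state v 0

  halts-suc : ∀ {v} st s → Halts v st s → Halts v st (suc s)
  halts-suc {v} st s h = trans (cong nextState h) (next-halted v)

  halts-≤ : ∀ {v st s s′} → s ≤′ s′ → Halts v st s → Halts v st s′
  halts-≤ (≤′-reflexive refl) h = h
  halts-≤ {v} {st} (≤′-step {s′} s≤s′) h = halts-suc st s′ (halts-≤ {v} {st} s≤s′ h)

  halts-pred : ∀ {v st′} st s → nextState st ≡ st′ → Halts v st (suc s) → Halts v st′ s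
  halts-pred st s refl h = trans (sym (run-suc st s)) h

  halts-next : ∀ {v st st′} s → nextState st ≡ st′ → Halts v st s → Halts v st′ s
  halts-next {v} {st} s eq h = halts-pred st s eq (halts-suc st s h)

  ⟶*⇒halts : ∀ {v st} → st ⟶* state v 0 → ∃[ s ] Halts v st s
  ⟶*⇒halts ε = 0 , refl
  ⟶*⇒halts {st = st} (refl ◅ r) with s , h ← ⟶*⇒halts r = suc s , trans (run-suc st s) h

  -- Halted states are fixed by `nextState`. No correctness of `o` enters, so this applies to the
  -- approximations `stage t` as well.
  evalWithin-mono : ∀ e n {y s s′} → s ≤ s′ → evalWithin o e n s ≡ suc y → evalWithin o e n s′ ≡ suc y
  evalWithin-mono e n {y} {s} s≤s′ eq = trans
    (cong result (halts-≤ {y} {state n (evalF e 0)} (≤⇒≤′ s≤s′)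
      (halted-result {run o (state n (evalF e 0)) s} eq)))
    (result-halted y)

-- Correctness of the machine

module _ {X : Pred ℕ 0ℓ} {o : ℕ → ℕ} (o-correct : ∀ q → oracle X q (o q)) where

  private
    open Machine o

    -- Tag 0 is excluded since the number 0 is its own child; this is why the induction hypotheses
    -- below are guarded by `t ≡ suc u`.
    children< : ∀ {e t j} → left e ≡ suc t → e < suc j → left (right e) < j × right (right e) < j
    children< {e} {t} {j} tag (s≤s e≤j) = childˡ< t m n e′≤j , childʳ< t m n e′≤j
      where
      m = left (right e)
      n = right (right e)
      e′≤j : ⟪ suc t , ⟪ m , n ⟫ ⟫ ≤ j
      e′≤j = subst (_≤ j) (sym (trans
        (cong₂ ⟪_,_⟫ (sym tag) (⟪left,right⟫ (right e))) (⟪left,right⟫ e))) e≤j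

    -- The stack `k` is arbitrary so that evaluations of subprograms can be nested.
    Simulates : ℕ → Graph → Set
    Simulates e F = ∀ {n y} k → F n y → state n (evalF e k) ⟶* state y k

    -- Invariant of the loop: of `s` rounds in all, `m` are done and `q` are left.
    simulate-prec : ∀ {l r F G} → Simulates l F → Simulates r G → ∀ {a z} k m q s → m + q ≡ s →
                    primRec F G a m z →
                    state a (evalF l (recurF r a 0 s k)) ⟶* state z (recurF r a m q k)
    simulate-prec C D k zero    q s refl p = C _ p
    simulate-prec {r = r} C D {a} k (suc m) q s eq (z , p , p′) =
      simulate-prec C D k m (suc q) s (trans (+-suc m q) eq) p
      ◅◅ next-recur z r a m (suc q) k
      ◅ D _ p′

    simulate-search : ∀ {l F} → Simulates l F → ∀ {n} k i →
                      (∀ j → j < i → ∃[ v ] F ⟪ n , j ⟫ (suc v)) →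
                      state ⟪ n , 0 ⟫ (evalF l (searchF l n 0 k))
                      ⟶* state ⟪ n , i ⟫ (evalF l (searchF l n i k))
    simulate-search C k zero    p = ε
    simulate-search {l} C {n} k (suc i) p with v , q ← p i ≤-refl =
      simulate-search C k i (λ j j<i → p j (m<n⇒m<1+n j<i))
      ◅◅ C _ q
      ◅◅ next-search (suc v) l n i k
      ◅ ε

    simulate-build : ∀ t l r c d → (∀ {u} → t ≡ suc u → Simulates l (⟦ c ⟧ X) × Simulates r (⟦ d ⟧ X)) →
                     ∀ {n y} k → ⟦ build t c d ⟧ X n y → evalStep (o n) n t l r k ⟶* state y k
    simulate-build 0 l r c d IH k refl = ε
    simulate-build 1 l r c d IH k refl = ε
    simulate-build 2 l r c d IH k refl = ε
    simulate-build 3 l r c d IH k refl = ε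
    simulate-build 4 l r c d IH {n} k p with refl ← ⟦⟧-functional oracleᶜ X n p (o-correct n) = ε
    simulate-build 5 l r c d IH {n} k (a , b , p , q , refl) with C , D ← IH refl =
      C _ p
      ◅◅ next-pairThen a r n k
      ◅ D _ q
      ◅◅ next-pairWith b a k
      ◅ ε
    simulate-build 6 l r c d IH k (z , p , q) with C , D ← IH refl = D _ p ◅◅ C k q
    simulate-build 7 l r c d IH {n} {y} k p with C , D ← IH refl =
      simulate-prec C D k (right n) 0 (right n) (+-identityʳ (right n)) p
      ◅◅ next-recur y r (left n) (right n) 0 k
      ◅ ε
    simulate-build (suc (suc (suc (suc (suc (suc (suc (suc t)))))))) l r c d IH {n} {y} k (p , p<)
      with C , _ ← IH refl =
      simulate-search C k y p<
      ◅◅ C _ p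
      ◅◅ next-search 0 l n y k
      ◅ ε

    simulate : ∀ j e → e < j → Simulates e (⟦ decodeWithin j e ⟧ X)
    simulate (suc j) e e<j {n} k p =
      next-eval n e k
      ◅ simulate-build (left e) l r (decodeWithin j l) (decodeWithin j r) IH k p
      where
      l = left (right e)
      r = right (right e)
      IH : ∀ {u} → left e ≡ suc u →
           Simulates l (⟦ decodeWithin j l ⟧ X) × Simulates r (⟦ decodeWithin j r ⟧ X)
      IH tag with l<j , r<j ← children< tag e<j = simulate j l l<j , simulate j r r<j

    -- Halting within s steps passes from a state to its successor with the same
    -- s, so only unbounded search has to count the steps.
    Sound : ℕ → Graph → Set
    Sound e F = ∀ {n v} k s → Halts v (state n (evalF e k)) s → ∃[ y ] F n y × Halts v (state y k) s

    sound-prec : ∀ {r F G} → Sound r G → ∀ {a z v} k s m q → primRec F G a m z →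
                 Halts v (state z (recurF r a m q k)) s →
                 ∃[ y ] primRec F G a (m + q) y × Halts v (state y k) s
    sound-prec {r} D {a} {z} k s m zero p h rewrite +-identityʳ m =
      z , p , halts-next s (next-recur z r a m 0 k) h
    sound-prec {r} D {a} {z} k s m (suc q) p h rewrite +-suc m q
      with y , p′ , h′ ← D (recurF r a (suc m) q k) s (halts-next s (next-recur z r a m (suc q) k) h) =
      sound-prec D k s (suc m) q (z , p , p′) h′

    sound-search : ∀ {l F} → Sound l F → ∀ {n v} k s i w →
                   (∀ j → j < i → ∃[ u ] F ⟪ n , j ⟫ (suc u)) → F ⟪ n , i ⟫ w →
                   Halts v (state w (searchF l n i k)) s →
                   ∃[ y ] minimize F n y × Halts v (state y k) s
    sound-search {l} C {n} {v} k zero i w p q h = contradiction h search≢halted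
    sound-search {l} C {n} k (suc s) i zero p q h = i , (q , p) ,
      halts-suc (state i k) s (halts-pred (state 0 (searchF l n i k)) s (next-search 0 l n i k) h)
    sound-search {l} C {n} {v} k (suc s) i (suc w) p q h
      with w′ , q′ , h₁ ← C {⟪ n , suc i ⟫} {v} (searchF l n (suc i) k) s
             (halts-pred (state (suc w) (searchF l n i k)) s (next-search (suc w) l n i k) h)
      with y , r , h₂ ← sound-search C k s (suc i) w′ (below-suc p (w , q)) q′ h₁ =
      y , r , halts-suc (state y k) s h₂

    sound-build : ∀ t l r c d → (∀ {u} → t ≡ suc u → Sound l (⟦ c ⟧ X) × Sound r (⟦ d ⟧ X)) →
                  ∀ {n v} k s → Halts v (evalStep (o n) n t l r k) s →
                  ∃[ y ] ⟦ build t c d ⟧ X n y × Halts v (state y k) s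
    sound-build 0 l r c d IH k s h = _ , refl , h
    sound-build 1 l r c d IH k s h = _ , refl , h
    sound-build 2 l r c d IH k s h = _ , refl , h
    sound-build 3 l r c d IH k s h = _ , refl , h
    sound-build 4 l r c d IH {n} k s h = _ , o-correct n , h
    sound-build 5 l r c d IH {n} k s h with C , D ← IH refl
      with a , p , h₁ ← C _ s h
      with b , q , h₂ ← D _ s (halts-next s (next-pairThen a r n k) h₁) =
      ⟪ a , b ⟫ , (a , b , p , q , refl) , halts-next s (next-pairWith b a k) h₂
    sound-build 6 l r c d IH k s h with C , D ← IH refl
      with z , p , h₁ ← D _ s h
      with y , q , h₂ ← C k s h₁ = y , (z , p , q) , h₂
    sound-build 7 l r c d IH {n} k s h with C , D ← IH refl
      with z , p , h₁ ← C _ s h = sound-prec D k s 0 (right n) p h₁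
    sound-build (suc (suc (suc (suc (suc (suc (suc (suc t)))))))) l r c d IH {n} k s h
      with C , _ ← IH refl
      with w , q , h₁ ← C _ s h = sound-search C k s 0 w (λ _ ()) q h₁

    sound : ∀ j e → e < j → Sound e (⟦ decodeWithin j e ⟧ X)
    sound (suc j) e e<j {n} k s h =
      sound-build (left e) l r (decodeWithin j l) (decodeWithin j r) IH k s
        (halts-next s (next-eval n e k) h)
      where
      l = left (right e)
      r = right (right e)
      IH : ∀ {u} → left e ≡ suc u →
           Sound l (⟦ decodeWithin j l ⟧ X) × Sound r (⟦ decodeWithin j r ⟧ X)
      IH tag with l<j , r<j ← children< tag e<j = sound j l l<j , sound j r r<j

  evalWithin-complete : ∀ e {n y} → Φ X e n y →
                        ∃[ s₀ ] ∀ s → s₀ ≤ s → evalWithin o e n s ≡ suc y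
  evalWithin-complete e {n} {y} p
    with s₀ , h ← ⟶*⇒halts (simulate (suc e) e ≤-refl 0 p) =
    s₀ , λ s s₀≤s → trans (cong result (halts-≤ {y} {state n (evalF e 0)} (≤⇒≤′ s₀≤s) h)) (result-halted y)

  evalWithin-sound : ∀ e {n y} s → evalWithin o e n s ≡ suc y → Φ X e n y
  evalWithin-sound e {n} {y} s eq
    with y′ , p , h ← sound (suc e) e ≤-refl 0 s (halted-result {run o (state n (evalF e 0)) s} eq) =
    -- `state y′ 0` has halted already, so `s` further steps lead both to itself and to `state y 0`;
    -- comparing results gives `y′ ≡ y`.
    subst (Φ X e n) (suc-injective (trans (sym (result-halted y′)) (trans
      (cong result (trans (sym (halts-≤ {y′} {state y′ 0} (≤⇒≤′ (z≤n {s})) refl)) h)) (result-halted y)))) p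

-- Finite cardinalities and eventual properties

Eventually : Pred ℕ 0ℓ → Set
Eventually P = ∃[ s₀ ] ∀ s → s₀ ≤ s → P s

eventually-map : {P Q : Pred ℕ 0ℓ} → (∀ s → P s → Q s) → Eventually P → Eventually Q
eventually-map P⊆Q (s₀ , p) = s₀ , λ s s₀≤s → P⊆Q s (p s s₀≤s)

eventually-× : {P Q : Pred ℕ 0ℓ} → Eventually P → Eventually Q → Eventually λ s → P s × Q s
eventually-× (s₀ , p) (s₁ , q) = s₀ ⊔ s₁ , λ s le →
  p s (≤-trans (m≤m⊔n s₀ s₁) le) , q s (≤-trans (m≤n⊔m s₀ s₁) le)

eventually-∀∈ : {A : Set} {Q : A → Pred ℕ 0ℓ} → (∀ x → Eventually (Q x)) →
                ∀ xs → Eventually λ s → ∀ {x} → x ∈ xs → Q x s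
eventually-∀∈ ev []       = 0 , λ _ _ ()
eventually-∀∈ ev (x ∷ xs) = eventually-map
  (λ { s (q , qs) (here refl) → q ; s (q , qs) (there x∈xs) → qs x∈xs })
  (eventually-× (ev x) (eventually-∀∈ ev xs))

sumBelow-mono : ∀ (q : ℕ → ℕ) {s t} → s ≤′ t → sumBelow q s ≤ sumBelow q t
sumBelow-mono q (≤′-reflexive refl)   = ≤-refl
sumBelow-mono q (≤′-step {t} s≤t) = ≤-trans (sumBelow-mono q s≤t) (m≤n+m _ (q t))

sumBelow-constant : ∀ (q : ℕ → ℕ) {s t} → s ≤′ t → sumBelow q s ≡ sumBelow q t →
                    ∀ i → s ≤ i → i < t → q i ≡ 0
sumBelow-constant q (≤′-reflexive refl) eq i s≤i i<s = contradiction i<s (≤⇒≯ s≤i)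
sumBelow-constant q {s} (≤′-step {t} s≤t) eq = λ i s≤i i<1+t →
  below-suc {λ i → s ≤ i → q i ≡ 0}
    (λ j j<t s≤j → sumBelow-constant q s≤t (trans eq (cong (_+ sumBelow q t) qt≡0)) j s≤j j<t)
    (λ _ → qt≡0) i i<1+t s≤i
  where
  qt≡0 : q t ≡ 0
  qt≡0 = n≤0⇒n≡0 (+-cancelʳ-≤ (sumBelow q t) (q t) 0
    (≤-trans (≤-reflexive (sym eq)) (sumBelow-mono q s≤t)))

-- A nonzero `q k` adds at most 1, and filtering `k` out of `xs` shortens the list while keeping all
-- smaller indices.
sumBelow≤length : ∀ (q : ℕ → ℕ) → (∀ i → q i ≤ 1) →
                  ∀ k xs → (∀ i → i < k → q i ≢ 0 → i ∈ xs) → sumBelow q k ≤ length xs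
sumBelow≤length q q≤1 zero    xs cover = z≤n
sumBelow≤length q q≤1 (suc k) xs cover with q k ≟ 0
... | yes eq rewrite eq = sumBelow≤length q q≤1 k xs λ i i<k → cover i (m<n⇒m<1+n i<k)
... | no neq = ≤-trans
  (+-mono-≤ (q≤1 k) (sumBelow≤length q q≤1 k rest λ i i<k qi≢0 →
    ∈-filter⁺ ≢k? (cover i (m<n⇒m<1+n i<k) qi≢0) (<⇒≢ i<k)))
  (filter-notAll ≢k? xs (Any.map (λ eq ≢k → ≢k (sym eq)) (cover k ≤-refl neq)))
  where
  ≢k? = λ i → ¬? (i ≟ k)
  rest = filter ≢k? xs

module Counting (em : ExcludedMiddle 0ℓ) where

  -- `HasCardinality` asks for an exact list without repetitions; excluded middle decides `P` on the
  -- covering list.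
  cardinality≤length : {P : Pred ℕ 0ℓ} (xs : List ℕ) → (∀ n → P n → n ∈ xs) →
                       CardinalityAtMost P (length xs)
  cardinality≤length {P} xs cover = length ys ,
    (ys , Unique.filter⁺ P? (deduplicate-! xs) , refl ,
      λ n → mk⇔ (λ p → ∈-filter⁺ P? (∈-deduplicate⁺ _≟_ (cover n p)) p)
                (λ n∈ys → proj₂ (∈-filter⁻ P? {xs = deduplicate _≟_ xs} n∈ys))) ,
    ≤-trans (length-filter P? (deduplicate _≟_ xs)) (length-deduplicate _≟_ xs)
    where
    P? : ∀ n → Dec (P n)
    P? n = em
    ys = filter P? (deduplicate _≟_ xs)

  image : {A : Set} (R : A → Pred ℕ 0ℓ) → (∀ x {m n} → R x m → R x n → m ≡ n) →
          ∀ xs → ∃[ ys ] length ys ≤ length xs × (∀ {x n} → x ∈ xs → R x n → n ∈ ys)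
  image R functional [] = [] , z≤n , λ ()
  image R functional (x ∷ xs) with ys , len , covers ← image R functional xs
    with em {∃[ n ] R x n}
  ... | yes (n , r) = n ∷ ys , s≤s len ,
    λ { (here refl) r′ → here (functional x r′ r) ; (there x∈xs) r′ → there (covers x∈xs r′) }
  ... | no ¬r = ys , m≤n⇒m≤1+n len ,
    λ { (here refl) r′ → contradiction (_ , r′) ¬r ; (there x∈xs) r′ → covers x∈xs r′ }

cardinality-≤ : ∀ {P b c} → b ≤ c → CardinalityAtMost P b → CardinalityAtMost P c
cardinality-≤ b≤c (k , card , k≤b) = k , card , ≤-trans k≤b b≤c

cardinality-< : ∀ {P b} → CardinalityAtMost P b → CardinalityLessThan P (suc b)
cardinality-< (k , card , k≤b) = k , card , s≤s k≤b

-- Computable approximations to ∅′ and the limit lemma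

-- The usual enumeration of `∅′`: the programs that halt on their own index within `t` steps.
stage : ℕ → ℕ → ℕ
stage t q = ifZero (evalWithin (λ _ → 0) q q t) 0 1

stageₐ : Algorithm₂ X stage
stageₐ = ifZeroₐ (evalWithinₐ (λ _ _ → 0) (constₐ 0) inner inner (leftₐ idₐ)) (constₐ 0) (constₐ 1)

module Characteristic (em : ExcludedMiddle 0ℓ) where

  indicator : {A : Set} → Dec A → ℕ
  indicator (yes _) = 1
  indicator (no _)  = 0

  χ : Pred ℕ 0ℓ → ℕ → ℕ
  χ X q = indicator (em {X q})

  χ-correct : ∀ X q → oracle X q (χ X q)
  χ-correct X q with em {X q}
  ... | yes x = inj₁ (x , refl)
  ... | no ¬x = inj₂ (¬x , refl)

  χₐ : Algorithm X (χ X)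
  χₐ {X} = oracleᶜ computes χ-correct X

  χ≡0 : ∀ X q → ¬ X q → χ X q ≡ 0
  χ≡0 X q ¬x with em {X q}
  ... | yes x = contradiction x ¬x
  ... | no _  = refl

  χ≡0⇒¬ : ∀ X q → χ X q ≡ 0 → ¬ X q
  χ≡0⇒¬ X q eq with em {X q}
  ... | no ¬x = ¬x

  stage-limit : ∀ q → Limit (λ t → stage t q) (χ ∅′ q)
  stage-limit q with em {∅′ q}
  ... | yes (y , p) = eventually-map (λ t eq → cong (λ r → ifZero r 0 1) eq)
    (evalWithin-complete (λ _ → inj₂ ((λ ()) , refl)) q p)
  ... | no ¬p = 0 , λ t _ → diverges t
    where
    diverges : ∀ t → stage t q ≡ 0
    diverges t with evalWithin (λ _ → 0) q q t in eq
    ... | zero  = refl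
    ... | suc y = contradiction (y , evalWithin-sound (λ _ → inj₂ ((λ ()) , refl)) q t eq) ¬p

  -- The use principle: `s` steps ask only `s` queries, and the stages eventually answer all of them
  -- correctly.
  run-limit : ∀ st s → Limit (λ t → run (stage t) st s) (run (χ ∅′) st s)
  run-limit st zero    = 0 , λ _ _ → refl
  run-limit st (suc s) = eventually-map
    (λ t (eq₁ , eq₂) → trans (cong (λ r → step (stage t (left r)) r) eq₁)
                             (cong (λ b → step b (run (χ ∅′) st s)) eq₂))
    (eventually-× (run-limit st s) (stage-limit (left (run (χ ∅′) st s))))

  -- At stage `t` the program for `f` is run for `t` steps with oracle `stage t`. The halting
  -- computation over `∅′` lasts some `s₀` steps; for large `t` these are reproduced, and the result
  -- then persists up to `t`.
  limit-lemma : {f : ℕ → ℕ → ℕ} → ComputableIn₂ ∅′ f →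
                ∃[ h ] (∀ {X} → Algorithm₂ X h) × (∀ m n → Limit (h ⟪ m , n ⟫) (f m n))
  limit-lemma {f} (e , p) = (λ x t → pred (evalWithin (stage t) e x t)) ,
    predₐ (evalWithinₐ (λ p → stage (right p)) (app₂ stage stageₐ (rightₐ (leftₐ idₐ)) inner)
      (constₐ e) (leftₐ idₐ) inner) ,
    λ m n → converges ⟪ m , n ⟫ (p m n)
    where
    converges : ∀ x {y} → Φ ∅′ e x y → Limit (λ t → pred (evalWithin (stage t) e x t)) y
    converges x halting with s₀ , halts ← evalWithin-complete (χ-correct ∅′) e halting = eventually-map
      (λ t (eq , s₀≤t) → cong pred (Machine.evalWithin-mono (stage t) e x s₀≤t
        (trans (cong result eq) (halts s₀ ≤-refl))))
      (eventually-× (run-limit (state x (evalF e 0)) s₀) (s₀ , λ _ s₀≤t → s₀≤t))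

-- Tracing the jump of ∅′ by a bounded approximation

module _ (em : ExcludedMiddle 0ℓ) (B : Pred ℕ 0ℓ) where

  open Counting em
  open Characteristic em

  BLR-hard⇒JT-hard : ∅′ ≤BLR B → ∅′ ≤JT B
  BLR-hard⇒JT-hard BLR⊆ = traces (BLR⊆ jumpValue∈BLR)
    where
    approximation : ℕ → ℕ → ℕ
    approximation n s = evalWithin (χ ∅′) n n s

    jumpValue : ℕ → ℕ
    jumpValue n with em {∃[ y ] J ∅′ n y}
    ... | yes (y , _) = suc y
    ... | no _        = 0

    jumpValue-correct : ∀ n {y} → J ∅′ n y → jumpValue n ≡ suc y
    jumpValue-correct n {y} p with em {∃[ y ] J ∅′ n y}
    ... | yes (z , q) = cong suc (⟦⟧-functional (decode n) ∅′ n q p)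
    ... | no ¬p       = contradiction (y , p) ¬p

    approximation-limit : ∀ n → Limit (approximation n) (jumpValue n)
    approximation-limit n with em {∃[ y ] J ∅′ n y}
    ... | yes (y , p) = evalWithin-complete (χ-correct ∅′) n p
    ... | no ¬p       = 0 , λ s _ → diverges s
      where
      diverges : ∀ s → approximation n s ≡ 0
      diverges s with approximation n s in eq
      ... | zero  = refl
      ... | suc y = contradiction (y , evalWithin-sound (χ-correct ∅′) n s eq) ¬p

    Start : ℕ → Pred ℕ 0ℓ
    Start n s = approximation n s ≡ 0 × approximation n (suc s) ≢ 0

    persists : ∀ n {s t} → s ≤ t → approximation n s ≢ 0 → approximation n t ≡ approximation n s
    persists n {s} s≤t ≢0 with approximation n s in eq
    ... | zero  = contradiction refl ≢0
    ... | suc y = Machine.evalWithin-mono (χ ∅′) n n s≤t eq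

    start-unique : ∀ n {s t} → Start n s → Start n t → s ≡ t
    start-unique n {s} {t} (s≡0 , s≢0) (t≡0 , t≢0) with <-cmp s t
    ... | tri≈ _ s≡t _ = s≡t
    ... | tri< s<t _ _ = contradiction (trans (sym (persists n s<t s≢0)) t≡0) s≢0
    ... | tri> _ _ t<s = contradiction (trans (sym (persists n t<s t≢0)) s≡0) t≢0

    change⇒start : ∀ n s → Changes (approximation n) s → Start n s
    change⇒start n s change with approximation n s ≟ 0
    ... | yes ≡0 = ≡0 , λ suc≡0 → change (trans ≡0 (sym suc≡0))
    ... | no ≢0  = contradiction (sym (persists n (n≤1+n s) ≢0)) change

    jumpValue∈BLR : BLR ∅′ jumpValue
    -- The bound is strict, so 2 allows the single change.
    jumpValue∈BLR = approximation , (λ _ → 2) ,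
      toComputable₂ (evalWithinₐ (λ _ → χ ∅′) (χₐ ∘ₐ inner) (leftₐ idₐ) (leftₐ idₐ) inner) ,
      toComputable (constₐ 2) ,
      λ n → approximation-limit n ,
        -- The one-element list is a dummy index set: a relation with at most one value has an image
        -- of length at most 1.
        (let ys , len , covers = image {ℕ} (λ _ → Start n) (λ _ → start-unique n) (0 ∷ []) in
         cardinality-< (cardinality-≤ len
           (cardinality≤length ys λ s change → covers (here refl) (change⇒start n s change))))

    traces : BLR B jumpValue → ∅′ ≤JT B
    traces (f̃ , g , f̃-computable , g-computable , spec) =
      program , g , toComputable programₐ , g-computable , traced , bounded
      where
      -- The trace consists of the predecessors of the positive values of `f̃ n`; the value 0 stands
      -- for divergence and contributes nothing.
      search : SearchIndex B λ n y s → ∣ f̃ n s - suc y ∣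
      search = searchIndex (λ n y s → ∣ f̃ n s - suc y ∣)
        ∣ app₂ f̃ (fromComputable₂ f̃-computable) (leftₐ (leftₐ idₐ)) inner
        - sucₐ (rightₐ (leftₐ idₐ)) ∣ₐ

      open SearchIndex search

      traced : ∀ n y → J ∅′ n y → W B (program n) y
      traced n y p = let (s , limit) , _ = spec n in
        complete n (m≡n⇒∣m-n∣≡0 (trans (limit s ≤-refl) (jumpValue-correct n p)))

      bounded : ∀ n → CardinalityAtMost (W B (program n)) (g n)
      bounded n = fromChanges (proj₂ (spec n))
        where
        fromChanges : CardinalityLessThan (Changes (f̃ n)) (g n) →
                      CardinalityAtMost (W B (program n)) (g n)
        fromChanges (_ , (changes , _ , refl , listed) , k<g) =
          cardinality-≤ (subst (_≤ g n) (sym length-values) k<g) (cardinality≤length values covers)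
          where
          times values : List ℕ
          -- Every value of `f̃ n` is taken at time 0 or just after a change. The extra time 0 is
          -- paid for by the strict bound on the changes.
          times  = 0 ∷ map suc changes
          values = map (pred ∘ f̃ n) times

          length-values : length values ≡ suc (length changes)
          length-values = trans (length-map (pred ∘ f̃ n) times) (cong suc (length-map suc changes))

          attained : ∀ s → ∃[ t ] t ∈ times × f̃ n s ≡ f̃ n t
          attained zero = 0 , here refl , refl
          attained (suc s) with f̃ n s ≟ f̃ n (suc s)
          ... | yes eq with t , t∈ , eq′ ← attained s = t , t∈ , trans (sym eq) eq′
          ... | no neq = suc s , there (∈-map⁺ suc (Equivalence.to (listed s) neq)) , refl

          covers : ∀ y → W B (program n) y → y ∈ values
          covers y (s , p) = let t , t∈ , eq = attained s in
            subst (_∈ values) (cong pred (trans (sym eq) (∣m-n∣≡0⇒m≡n (sound n p))))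
              (∈-map⁺ (pred ∘ f̃ n) t∈)

-- Bounded approximation from a trace

constant-between : ∀ (a : ℕ → ℕ) {s t} → s ≤′ t → (∀ i → s ≤ i → i < t → a i ≡ a (suc i)) → a s ≡ a t
constant-between a (≤′-reflexive refl) step≡ = refl
constant-between a (≤′-step {t} s≤t) step≡ = trans
  (constant-between a s≤t λ i s≤i i<t → step≡ i s≤i (m<n⇒m<1+n i<t))
  (step≡ t (≤′⇒≤ s≤t) ≤-refl)

-- The moments at which an upward closed property becomes true
Onset : Pred ℕ 0ℓ → Pred ℕ 0ℓ
Onset Q s = ¬ Q s × Q (suc s)

onset-unique : {Q : Pred ℕ 0ℓ} → (∀ {s t} → s ≤ t → Q s → Q t) →
               ∀ {s t} → Onset Q s → Onset Q t → s ≡ t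
onset-unique up {s} {t} (¬s , s′) (¬t , t′) with <-cmp s t
... | tri≈ _ s≡t _ = s≡t
... | tri< s<t _ _ = contradiction (up s<t s′) ¬t
... | tri> _ _ t<s = contradiction (up t<s t′) ¬s

module _ (em : ExcludedMiddle 0ℓ) (B : Pred ℕ 0ℓ) where

  open Counting em
  open Characteristic em

  -- A candidate m = ⟪ s , t ⟫ for n claims that the approximation f̃ n has
  -- settled at s, and that h ⟪ n , s ⟫ is constant from t on. Indices e n i
  -- (i < γ n) of sets c.e. in B supply the candidates.
  module Candidates (h e : ℕ → ℕ → ℕ) (γ : ℕ → ℕ)
                    (hₐ : ∀ {X} → Algorithm₂ X h) (eₐ : Algorithm₂ B e) (γₐ : Algorithm B γ) where

    -- `enumerated` and `moved` are truth values, nonzero meaning true. The score of a live pair is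
    -- shifted by one, which leaves 0 to say that no pair is live.
    enumerated moved score : ℕ → ℕ → ℕ → ℕ
    enumerated n m σ = maxBelow (λ i → evalWithin (χ B) (e n i) m σ) (γ n)
    -- With the bound `suc σ` the offset `d` may be `σ ∸ right m`, so the test reaches stage `σ`
    -- itself.
    moved n m σ = maxBelow (λ d → ∣ h ⟪ n , left m ⟫ (right m + d) - h ⟪ n , left m ⟫ (right m) ∣) (suc σ)
    score n m σ = ifZero (enumerated n m σ) 0 (ifZero (moved n m σ) (suc (left m)) 0)

    best output : ℕ → ℕ → ℕ
    best n σ = maxBelow (λ m → score n m σ) σ
    -- `h` is read at the current stage, not at the modulus of the winning pair: the output depends
    -- on the largest `left m` alone, not on which pair attains it.
    output n σ = ifZero (best n σ) 0 (h ⟪ n , pred (best n σ) ⟫ σ)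

    enumeratedₐ : ∀ {n m σ} → Algorithm B n → Algorithm B m → Algorithm B σ →
                  Algorithm B λ x → enumerated (n x) (m x) (σ x)
    enumeratedₐ {n} {m} {σ} nₐ mₐ σₐ =
      maxBelowₐ (λ x i → evalWithin (χ B) (e (n x) i) (m x) (σ x))
        (evalWithinₐ (λ _ → χ B) (χₐ ∘ₐ inner) (app₂ e eₐ (outer nₐ) inner) (outer mₐ) (outer σₐ))
        (γₐ ∘ₐ nₐ)

    movedₐ : ∀ {n m σ} → Algorithm B n → Algorithm B m → Algorithm B σ →
             Algorithm B λ x → moved (n x) (m x) (σ x)
    movedₐ {n} {m} {σ} nₐ mₐ σₐ =
      maxBelowₐ (λ x d → ∣ h ⟪ n x , left (m x) ⟫ (right (m x) + d)
                         - h ⟪ n x , left (m x) ⟫ (right (m x)) ∣)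
        ∣ app₂ h hₐ (outer ⟪ nₐ , leftₐ mₐ ⟫ₐ) (outer (rightₐ mₐ) +ₐ inner)
        - app₂ h hₐ (outer ⟪ nₐ , leftₐ mₐ ⟫ₐ) (outer (rightₐ mₐ)) ∣ₐ
        (sucₐ σₐ)

    bestₐ : ∀ {n σ} → Algorithm B n → Algorithm B σ → Algorithm B λ x → best (n x) (σ x)
    bestₐ {n} {σ} nₐ σₐ = maxBelowₐ (λ x m → score (n x) m (σ x))
      (ifZeroₐ (enumeratedₐ (outer nₐ) inner (outer σₐ)) (constₐ 0)
        (ifZeroₐ (movedₐ (outer nₐ) inner (outer σₐ)) (sucₐ (leftₐ inner)) (constₐ 0)))
      σₐ

    outputₐ : Algorithm₂ B output
    outputₐ = ifZeroₐ b (constₐ 0) (app₂ h hₐ ⟪ leftₐ idₐ , predₐ b ⟫ₐ inner)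
      where
      b : Algorithm B λ p → best (left p) (right p)
      b = bestₐ (leftₐ idₐ) inner

    -- `m < σ` matches the range searched by `best`, and it gives `right m ≤ m < σ`, so that a pair
    -- is used only from its claimed modulus on.
    Entered Moved : ℕ → ℕ → Pred ℕ 0ℓ
    Entered n m σ = m < σ × ∃[ i ] i < γ n × ∃[ v ] evalWithin (χ B) (e n i) m σ ≡ suc v
    Moved n m σ = ∃[ d ] d < suc σ × h ⟪ n , left m ⟫ (right m + d) ≢ h ⟪ n , left m ⟫ (right m)

    Live : ℕ → ℕ → Pred ℕ 0ℓ
    Live n m σ = Entered n m σ × ¬ Moved n m σ

    entered-up : ∀ n m {σ τ} → σ ≤ τ → Entered n m σ → Entered n m τ
    entered-up n m σ≤τ (m<σ , i , i<γ , v , eq) =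
      <-≤-trans m<σ σ≤τ , i , i<γ , v , Machine.evalWithin-mono (χ B) (e n i) m σ≤τ eq

    moved-up : ∀ n m {σ τ} → σ ≤ τ → Moved n m σ → Moved n m τ
    moved-up n m σ≤τ (d , d<σ , neq) = d , <-≤-trans d<σ (s≤s σ≤τ) , neq

    Candidate : ℕ → Pred ℕ 0ℓ
    Candidate n m = ∃[ i ] i < γ n × W B (e n i) m

    entered⇒candidate : ∀ n m σ → Entered n m σ → Candidate n m
    entered⇒candidate n m σ (_ , i , i<γ , v , eq) =
      i , i<γ , v , evalWithin-sound (χ-correct B) (e n i) σ eq

    candidate⇒entered : ∀ n m → Candidate n m → Eventually (Entered n m)
    candidate⇒entered n m (i , i<γ , v , p) = eventually-map
      (λ σ (m<σ , eq) → m<σ , i , i<γ , v , eq)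
      (eventually-× (suc m , λ _ m<σ → m<σ) (evalWithin-complete (χ-correct B) (e n i) p))

    settled : ∀ n m {σ} → m < σ → ¬ Moved n m σ → h ⟪ n , left m ⟫ σ ≡ h ⟪ n , left m ⟫ (right m)
    settled n m {σ} m<σ ¬moved with h ⟪ n , left m ⟫ σ ≟ h ⟪ n , left m ⟫ (right m)
    ... | yes eq = eq
    ... | no neq = contradiction (σ ∸ right m , s≤s (m∸n≤m σ (right m)) ,
                                  subst (λ τ → h ⟪ n , left m ⟫ τ ≢ h ⟪ n , left m ⟫ (right m))
                                    (sym (m+[n∸m]≡n right≤σ)) neq) ¬moved
      where
      right≤σ : right m ≤ σ
      right≤σ = ≤-trans
        (subst (right m ≤_) (⟪left,right⟫ m) (n≤⟪m,n⟫ (left m) (right m))) (<⇒≤ m<σ)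

    moved-sound : ∀ n m σ {v} → moved n m σ ≡ suc v → Moved n m σ
    moved-sound n m σ eq with d , d<σ , eq′ ← maxBelow-attained _ (suc σ) eq =
      d , d<σ , λ same → contradiction (trans (sym (m≡n⇒∣m-n∣≡0 same)) eq′) λ ()

    moved-zero : ∀ n m σ → moved n m σ ≡ 0 → ¬ Moved n m σ
    moved-zero n m σ eq (d , d<σ , neq) = neq (∣m-n∣≡0⇒m≡n (n≤0⇒n≡0
      (subst (_ ≤_) eq (maxBelow-upper
        (λ d → ∣ h ⟪ n , left m ⟫ (right m + d) - h ⟪ n , left m ⟫ (right m) ∣) (suc σ) d<σ))))

    live⇒score : ∀ n m σ → Live n m σ → score n m σ ≡ suc (left m)
    live⇒score n m σ ((m<σ , i , i<γ , v , eq) , ¬moved) with enumerated n m σ in enum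
    ... | zero  = contradiction
      (≤-trans (≤-reflexive (sym eq))
        (≤-trans (maxBelow-upper (λ i → evalWithin (χ B) (e n i) m σ) (γ n) i<γ) (≤-reflexive enum)))
      λ ()
    ... | suc _ with moved n m σ in mov
    ...   | zero  = refl
    ...   | suc _ = contradiction (moved-sound n m σ mov) ¬moved

    score⇒live : ∀ n m σ {s} → m < σ → score n m σ ≡ suc s → Live n m σ × left m ≡ s
    score⇒live n m σ m<σ eq with enumerated n m σ in enum
    ... | suc _ with moved n m σ in mov
    ...   | zero with i , i<γ , eq′ ← maxBelow-attained _ (γ n) enum =
      ((m<σ , i , i<γ , _ , eq′) , moved-zero n m σ mov) , suc-injective eq

    best-upper : ∀ n m σ → Live n m σ → suc (left m) ≤ best n σ
    best-upper n m σ live = subst (_≤ best n σ) (live⇒score n m σ live)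
      (maxBelow-upper (λ m → score n m σ) σ (proj₁ (proj₁ live)))

    best-attained : ∀ n σ {s} → best n σ ≡ suc s → ∃[ m ] Live n m σ × left m ≡ s
    best-attained n σ eq with m , m<σ , eq′ ← maxBelow-attained (λ m → score n m σ) σ eq =
      m , score⇒live n m σ m<σ eq′

    best-mono : ∀ n σ τ → (∀ m → Live n m σ → Live n m τ) → best n σ ≤ best n τ
    best-mono n σ τ live⊆ with best n σ in eq
    ... | zero = z≤n
    ... | suc s with m , live , refl ← best-attained n σ eq = best-upper n m τ (live⊆ m live)

    -- With the same live pairs `best` is the same, and a pair attaining it is live at both stages;
    -- by `settled` both outputs are its value at `right m`.
    output-constant : ∀ n σ → (∀ m → Live n m σ → Live n m (suc σ)) →
                      (∀ m → Live n m (suc σ) → Live n m σ) → output n σ ≡ output n (suc σ)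
    output-constant n σ into back
      with best n σ in eq | best n (suc σ) | ≤-antisym (best-mono n σ (suc σ) into) (best-mono n (suc σ) σ back)
    ... | zero  | _ | refl = refl
    ... | suc s | _ | refl with m , live , refl ← best-attained n σ eq = trans
      (settled n m (proj₁ (proj₁ live)) (proj₂ live))
      (sym (settled n m (proj₁ (proj₁ (into m live))) (proj₂ (into m live))))

    change⇒onset : ∀ n σ → Changes (output n) σ →
                   ∃[ m ] Candidate n m × (Onset (Entered n m) σ ⊎ Onset (Moved n m) σ)
    change⇒onset n σ change
      with em {∃[ m ] Candidate n m × (Onset (Entered n m) σ ⊎ Onset (Moved n m) σ)}
    ... | yes p = p
    ... | no ¬p = contradiction (output-constant n σ into back) change
      where
      into : ∀ m → Live n m σ → Live n m (suc σ)
      into m (entered , ¬moved) = entered-up n m (n≤1+n σ) entered , λ moved →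
        ¬p (m , entered⇒candidate n m σ entered , inj₂ (¬moved , moved))
      back : ∀ m → Live n m (suc σ) → Live n m σ
      back m (entered , ¬moved) with em {Entered n m σ}
      ... | yes entered′ = entered′ , ¬moved ∘ moved-up n m (n≤1+n σ)
      ... | no ¬entered  = contradiction
        (m , entered⇒candidate n m (suc σ) entered , inj₁ (¬entered , entered)) ¬p

    -- `Entered` and `Moved` are upward closed, so each candidate has at most one onset of either
    -- kind.
    changes≤ : ∀ n pool → (∀ m → Candidate n m → m ∈ pool) →
               CardinalityAtMost (Changes (output n)) (length pool + length pool)
    changes≤ n pool complete
      with xs , xs≤ , xs-covers ← image (λ m → Onset (Entered n m))
                                    (λ m → onset-unique (entered-up n m)) pool
         | ys , ys≤ , ys-covers ← image (λ m → Onset (Moved n m))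
                                    (λ m → onset-unique (moved-up n m)) pool =
      cardinality-≤ (subst (_≤ length pool + length pool) (sym (length-++ xs)) (+-mono-≤ xs≤ ys≤))
        (cardinality≤length (xs ++ ys) λ σ change → covers σ (change⇒onset n σ change))
      where
      covers : ∀ σ → ∃[ m ] Candidate n m × (Onset (Entered n m) σ ⊎ Onset (Moved n m) σ) →
               σ ∈ xs ++ ys
      covers σ (m , cand , inj₁ onset) = ∈-++⁺ˡ (xs-covers (complete m cand) onset)
      covers σ (m , cand , inj₂ onset) = ∈-++⁺ʳ xs (ys-covers (complete m cand) onset)

    -- The pool is finite, so from some stage on every candidate that ever moves has been seen to
    -- move. The winner then never moves, and its `left` is at least that of the correct `m`.
    output-limit : ∀ n pool {l} → (∀ m → Candidate n m → m ∈ pool) →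
                   ∀ {m} → Candidate n m → (∀ σ → ¬ Moved n m σ) →
                   (∀ s → left m ≤ s → Limit (h ⟪ n , s ⟫) l) →
                   Limit (output n) l
    output-limit n pool {l} complete {m} cand ¬moved correct = eventually-map
      (λ σ (entered , stable) → value σ entered stable)
      (eventually-× (candidate⇒entered n m cand) (eventually-∀∈ stabilises pool))
      where
      Stable : ℕ → Pred ℕ 0ℓ
      Stable m′ σ = ¬ Moved n m′ σ → ∀ τ → ¬ Moved n m′ τ

      stabilises : ∀ m′ → Eventually (Stable m′)
      stabilises m′ with em {∃[ τ ] Moved n m′ τ}
      ... | yes (τ , mov) = τ , λ σ τ≤σ ¬mov → contradiction (moved-up n m′ τ≤σ mov) ¬mov
      ... | no ¬mov       = 0 , λ _ _ _ τ mov → ¬mov (τ , mov)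

      value : ∀ σ → Entered n m σ → (∀ {m′} → m′ ∈ pool → Stable m′ σ) → output n σ ≡ l
      value σ entered stable with best n σ in eq | best-upper n m σ (entered , ¬moved σ)
      ... | suc s | s≤s m≤s with m′ , (entered′ , ¬moved′) , refl ← best-attained n σ eq
        with t₀ , limit ← correct (left m′) m≤s = trans
          (settled n m′ (proj₁ entered′) ¬moved′)
          -- Since `m′` never moves, its value may be compared with the limit at a stage past both
          -- `m′` and `t₀`.
          (trans (sym (settled n m′ (m≤m⊔n (suc m′) t₀)
                   (stable (complete m′ (entered⇒candidate n m′ σ entered′)) ¬moved′ (suc m′ ⊔ t₀))))
                 (limit (suc m′ ⊔ t₀) (m≤n⊔m (suc m′) t₀)))

-- Counting changes

differs : (ℕ → ℕ) → ℕ → ℕ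
differs a i = ifZero ∣ a i - a (suc i) ∣ 0 1

changesBelow : (ℕ → ℕ) → ℕ → ℕ
changesBelow a = sumBelow (differs a)

changesBelowₐ : ∀ {s : ℕ → ℕ} (a : ℕ → ℕ → ℕ) → Algorithm₂ X a → Algorithm X s →
                Algorithm X λ x → changesBelow (a x) (s x)
changesBelowₐ a aₐ = sumBelowₐ (λ x → differs (a x))
  (ifZeroₐ ∣ aₐ - app₂ a aₐ (leftₐ idₐ) (sucₐ inner) ∣ₐ (constₐ 0) (constₐ 1))

-- Makes the number of changes before any stage an admissible index `i < γ n`.
changesBelow≤ : ∀ {a k} → CardinalityLessThan (Changes a) k → ∀ s → changesBelow a s < k
changesBelow≤ {a} (_ , (changes , _ , refl , complete) , len<k) s = ≤-<-trans
  (sumBelow≤length (differs a) ≤1 s changes λ i _ neq →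
    Equivalence.to (complete i) λ eq → neq (cong (λ d → ifZero d 0 1) (m≡n⇒∣m-n∣≡0 eq)))
  len<k
  where
  ≤1 : ∀ i → differs a i ≤ 1
  ≤1 i with ∣ a i - a (suc i) ∣
  ... | zero  = z≤n
  ... | suc _ = ≤-refl

changesBelow-constant : ∀ a {s t} → s ≤ t → changesBelow a s ≡ changesBelow a t →
                        ∀ i → s ≤ i → i ≤ t → a i ≡ a t
changesBelow-constant a s≤t eq i s≤i i≤t = constant-between a (≤⇒≤′ i≤t) λ j i≤j j<t →
  same j (sumBelow-constant (differs a) (≤⇒≤′ s≤t) eq j (≤-trans s≤i i≤j) j<t)
  where
  same : ∀ j → differs a j ≡ 0 → a j ≡ a (suc j)
  same j eq with ∣ a j - a (suc j) ∣ in dist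
  ... | zero = ∣m-n∣≡0⇒m≡n dist

-- Finding candidates with the jump of ∅′

Stable : (ℕ → ℕ) → Pred ℕ 0ℓ
Stable a t = ∀ d → a (t + d) ≡ a t

limit⇒stable : ∀ {a l} ((t , _) : Limit a l) → Stable a t
limit⇒stable (t , limit) d = trans (limit (t + d) (m≤m+n t d)) (sym (limit t ≤-refl))

-- Moving after `t` is a c.e. event, so a single query to `∅′` settles whether `t` is a modulus.
record StabilityIndex (h : ℕ → ℕ → ℕ) : Set where
  field
    program  : ℕ → ℕ
    programₐ : Algorithm ∅ program
    stable   : ∀ x t → ¬ ∅′ (program ⟪ x , t ⟫) → Stable (h x) t
    unstable : ∀ x t → Stable (h x) t → ¬ ∅′ (program ⟪ x , t ⟫)

private
  distinct : ∀ {m n} → m ≢ n → ifZero ∣ m - n ∣ 1 0 ≡ 0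
  distinct {m} {n} neq with ∣ m - n ∣ in dist
  ... | zero  = contradiction (∣m-n∣≡0⇒m≡n dist) neq
  ... | suc _ = refl

stabilityIndex : (h : ℕ → ℕ → ℕ) → Algorithm₂ ∅ h → StabilityIndex h
stabilityIndex h hₐ =
  record { program = program ; programₐ = programₐ ; stable = stable ; unstable = unstable }
  where
  moves : ℕ → ℕ → ℕ → ℕ
  -- The input of the program is ignored, so it halts on its own index exactly when it halts at all;
  -- this places the event in `∅′`.
  moves z _ d = ifZero ∣ h (left z) (right z + d) - h (left z) (right z) ∣ 1 0

  search : SearchIndex ∅ moves
  search = searchIndex moves (ifZeroₐ
    ∣ app₂ h hₐ (leftₐ (leftₐ (leftₐ idₐ))) (rightₐ (leftₐ (leftₐ idₐ)) +ₐ inner)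
    - app₂ h hₐ (leftₐ (leftₐ (leftₐ idₐ))) (rightₐ (leftₐ (leftₐ idₐ))) ∣ₐ
    (constₐ 1) (constₐ 0))

  open SearchIndex search

  moves-⟪⟫ : ∀ x t y d → moves ⟪ x , t ⟫ y d ≡ ifZero ∣ h x (t + d) - h x t ∣ 1 0
  moves-⟪⟫ x t y d = cong₂ (λ x t → ifZero ∣ h x (t + d) - h x t ∣ 1 0) (left-⟪⟫ x t) (right-⟪⟫ x t)

  stable : ∀ x t → ¬ ∅′ (program ⟪ x , t ⟫) → Stable (h x) t
  stable x t ¬∅′ d = decidable-stable (h x (t + d) ≟ h x t) λ neq →
    ¬∅′ (complete ⟪ x , t ⟫ {program ⟪ x , t ⟫} {d}
      (trans (moves-⟪⟫ x t (program ⟪ x , t ⟫) d) (distinct neq)))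

  unstable : ∀ x t → Stable (h x) t → ¬ ∅′ (program ⟪ x , t ⟫)
  unstable x t st (d , p) = contradiction
    (trans (sym (trans (moves-⟪⟫ x t 0 d) (cong (λ k → ifZero k 1 0) (m≡n⇒∣m-n∣≡0 (st d)))))
      (sound ⟪ x , t ⟫ p))
    λ ()

-- Given n and i, the jump of ∅′ finds a stage s before which f̃ n changes
-- exactly i times, together with a modulus t for h ⟪ n , s ⟫.
record CandidateIndex (f̃ h : ℕ → ℕ → ℕ) : Set where
  field
    program  : ℕ → ℕ
    programₐ : Algorithm ∅ program
    sound    : ∀ n i {m} → J ∅′ (program ⟪ n , i ⟫) m →
               changesBelow (f̃ n) (left m) ≡ i × Stable (h ⟪ n , left m ⟫) (right m)
    complete : ∀ n s {t} → Stable (h ⟪ n , s ⟫) t →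
               ∃[ m ] J ∅′ (program ⟪ n , changesBelow (f̃ n) s ⟫) m

module _ (em : ExcludedMiddle 0ℓ) where

  open Counting em
  open Characteristic em

  candidateIndex : (f̃ h : ℕ → ℕ → ℕ) → Algorithm₂ ∅′ f̃ → Algorithm₂ ∅ h → CandidateIndex f̃ h
  candidateIndex f̃ h f̃ₐ hₐ =
    record { program = program ; programₐ = programₐ ; sound = found ; complete = exists }
    where
    stability : StabilityIndex h
    stability = stabilityIndex h hₐ

    module Q = StabilityIndex stability

    q : ℕ → ℕ → ℕ → ℕ
    q n s t = Q.program ⟪ ⟪ n , s ⟫ , t ⟫

    test₀ : ℕ → ℕ → ℕ → ℕ
    test₀ n i m = ∣ changesBelow (f̃ n) (left m) - i ∣ + χ ∅′ (q n (left m) (right m))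

    test : ℕ → ℕ → ℕ → ℕ
    -- Again the input is ignored, so that the search can be run on the program's own index and its
    -- result is a value of `J ∅′`.
    test x _ m = test₀ (left x) (right x) m

    testₐ : Algorithm ∅′ λ p → test (left (left p)) (right (left p)) (right p)
    testₐ =
      ∣ changesBelowₐ (λ p → f̃ (left (left (left p))))
          (app₂ f̃ f̃ₐ (leftₐ (leftₐ (leftₐ (leftₐ idₐ)))) inner) (leftₐ inner)
      - rightₐ (leftₐ (leftₐ idₐ)) ∣ₐ
      +ₐ (χₐ ∘ₐ relativise Q.programₐ
             ∘ₐ ⟪ ⟪ leftₐ (leftₐ (leftₐ idₐ)) , leftₐ inner ⟫ₐ , rightₐ inner ⟫ₐ)

    search : SearchIndex ∅′ test
    search = searchIndex test testₐ

    open SearchIndex search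

    test-⟪⟫ : ∀ n i y m → test ⟪ n , i ⟫ y m ≡ test₀ n i m
    test-⟪⟫ n i y m = cong₂ (λ n i → test₀ n i m) (left-⟪⟫ n i) (right-⟪⟫ n i)

    found : ∀ n i {m} → J ∅′ (program ⟪ n , i ⟫) m →
            changesBelow (f̃ n) (left m) ≡ i × Stable (h ⟪ n , left m ⟫) (right m)
    found n i {m} p =
      ∣m-n∣≡0⇒m≡n (m+n≡0⇒m≡0 _ zeros) ,
      Q.stable ⟪ n , left m ⟫ (right m)
        (χ≡0⇒¬ ∅′ (q n (left m) (right m)) (m+n≡0⇒n≡0 ∣ changesBelow (f̃ n) (left m) - i ∣ zeros))
      where
      zeros : test₀ n i m ≡ 0
      zeros = trans (sym (test-⟪⟫ n i 0 m)) (sound ⟪ n , i ⟫ p)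

    exists : ∀ n s {t} → Stable (h ⟪ n , s ⟫) t →
             ∃[ m ] J ∅′ (program ⟪ n , changesBelow (f̃ n) s ⟫) m
    exists n s {t} stable = complete ⟪ n , i ⟫ {_} {⟪ s , t ⟫}
      (trans (test-⟪⟫ n i 0 ⟪ s , t ⟫) (trans
        (cong₂ (λ s t → ∣ changesBelow (f̃ n) s - i ∣ + χ ∅′ (q n s t)) (left-⟪⟫ s t) (right-⟪⟫ s t))
        (cong₂ _+_ (∣n-n∣≡0 i) (χ≡0 ∅′ (q n s t) (Q.unstable ⟪ n , s ⟫ t stable)))))
      where
      i : ℕ
      i = changesBelow (f̃ n) s

  -- The approximation built from a trace

  module FromTrace
    (B : Pred ℕ 0ℓ) (tr bd γ φ : ℕ → ℕ) (f̃ h : ℕ → ℕ → ℕ)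
    (trₐ : Algorithm ∅ tr) (bdₐ : Algorithm ∅ bd) (γₐ : Algorithm ∅ γ)
    (hₐ : ∀ {X} → Algorithm₂ X h)
    (traced : ∀ n y → J ∅′ n y → W B (tr n) y)
    (bounded : ∀ n → CardinalityAtMost (W B (tr n)) (bd n))
    (spec : ∀ n → Limit (f̃ n) (φ n) × CardinalityLessThan (Changes (f̃ n)) (γ n))
    (h-limit : ∀ n s → Limit (h ⟪ n , s ⟫) (f̃ n s))
    (candidates : CandidateIndex f̃ h)
    where

    open CandidateIndex candidates renaming (program to r; programₐ to rₐ)

    e : ℕ → ℕ → ℕ
    e n i = tr (r ⟪ n , i ⟫)

    eₐ : Algorithm₂ B e
    eₐ = relativise trₐ ∘ₐ relativise rₐ ∘ₐ ⟪ leftₐ idₐ , inner ⟫ₐ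

    open Candidates em B h e γ hₐ eₐ (relativise γₐ)

    size : ℕ → ℕ → ℕ
    size n i = bd (r ⟪ n , i ⟫)

    sizesₐ : Algorithm ∅ λ n → sumBelow (size n) (γ n)
    sizesₐ = sumBelowₐ size (bdₐ ∘ₐ rₐ ∘ₐ ⟪ leftₐ idₐ , inner ⟫ₐ)
      γₐ

    bound : ℕ → ℕ
    -- Each candidate costs at most two changes, and `suc` makes the bound strict.
    bound n = suc (sumBelow (size n) (γ n) + sumBelow (size n) (γ n))

    boundₐ : Algorithm ∅ bound
    boundₐ = sucₐ (sizesₐ +ₐ sizesₐ)

    -- The lists are extracted from the cardinality proofs and need not be computable in `B`; they
    -- serve the verification only, not the algorithm for `output`.
    pool : ℕ → ℕ → List ℕ
    pool n zero    = []
    pool n (suc k) = proj₁ (proj₁ (proj₂ (bounded (r ⟪ n , k ⟫)))) ++ pool n k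

    pool-length : ∀ n k → length (pool n k) ≤ sumBelow (size n) k
    pool-length n zero = z≤n
    pool-length n (suc k) with bounded (r ⟪ n , k ⟫)
    ... | _ , (xs , _ , refl , _) , xs≤ =
      subst (_≤ size n k + sumBelow (size n) k) (sym (length-++ xs)) (+-mono-≤ xs≤ (pool-length n k))

    pool-∈ : ∀ n k i {m} → i < k → W B (e n i) m → m ∈ pool n k
    pool-∈ n (suc k) i {m} (s≤s i≤k) w with m≤n⇒m<n∨m≡n i≤k
    ... | inj₁ i<k  = ∈-++⁺ʳ (proj₁ (proj₁ (proj₂ (bounded (r ⟪ n , k ⟫))))) (pool-∈ n k i i<k w)
    ... | inj₂ refl with bounded (r ⟪ n , k ⟫)
    ...   | _ , (_ , _ , _ , listed) , _ = ∈-++⁺ˡ (Equivalence.to (listed m) w)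

    pool-complete : ∀ n m → Candidate n m → m ∈ pool n (γ n)
    pool-complete n m (i , i<γ , w) = pool-∈ n (γ n) i i<γ w

    limit : ∀ n → Limit (output n) (φ n)
    limit n = output-limit n (pool n (γ n)) (pool-complete n)
      (i , changesBelow≤ (proj₂ (spec n)) s₀ , traced (r ⟪ n , i ⟫) m found)
      (λ σ (d , _ , moves) → moves (proj₂ found-sound d)) converges
      where
      s₀ = proj₁ (proj₁ (spec n))
      settles = proj₂ (proj₁ (spec n))
      -- With this index, the pair found need not name `s₀`, but it names a stage preceded by
      -- equally many changes.
      i = changesBelow (f̃ n) s₀

      search : ∃[ m ] J ∅′ (r ⟪ n , i ⟫) m
      search = complete n s₀ (limit⇒stable (h-limit n s₀))

      m = proj₁ search
      found = proj₂ search

      found-sound : changesBelow (f̃ n) (left m) ≡ i × Stable (h ⟪ n , left m ⟫) (right m)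
      found-sound = sound n i found

      converges : ∀ s → left m ≤ s → Limit (h ⟪ n , s ⟫) (φ n)
      converges s m≤s = subst (Limit (h ⟪ n , s ⟫)) (f̃≡φ (≤-total s₀ s)) (h-limit n s)
        where
        f̃≡φ : s₀ ≤ s ⊎ s ≤ s₀ → f̃ n s ≡ φ n
        f̃≡φ (inj₁ s₀≤s) = settles s s₀≤s
        f̃≡φ (inj₂ s≤s₀) = trans
          -- Equal counts before `left m` and before `s₀` leave no change between the two stages.
          (changesBelow-constant (f̃ n) (≤-trans m≤s s≤s₀) (proj₁ found-sound) s m≤s s≤s₀)
          (settles s₀ ≤-refl)

    φ∈BLR : BLR B φ
    φ∈BLR = output , bound , toComputable₂ outputₐ , toComputable boundₐ ,
      λ n → limit n , cardinality-< (cardinality-≤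
        (+-mono-≤ (pool-length n (γ n)) (pool-length n (γ n)))
        (changes≤ n (pool n (γ n)) (pool-complete n)))

  JT-hard⇒BLR-hard : ∀ B → ∅′ ≤JT B → ∅′ ≤BLR B
  JT-hard⇒BLR-hard B (tr , bd , tr-computable , bd-computable , traced , bounded)
                   {φ} (f̃ , γ , f̃-computable , γ-computable , spec)
    with h , hₐ , h-limit ← limit-lemma {f̃} f̃-computable
    = FromTrace.φ∈BLR B tr bd γ φ f̃ h
      (fromComputable {f = tr} tr-computable) (fromComputable {f = bd} bd-computable)
      (fromComputable {f = γ} γ-computable) hₐ traced bounded spec h-limit
      (candidateIndex f̃ h (fromComputable₂ {f = f̃} f̃-computable) hₐ)

corollary2p5 : ExcludedMiddle 0ℓ → (B : Pred ℕ 0ℓ) → (∅′ ≤JT B) ⇔ (∅′ ≤BLR B)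
corollary2p5 em B = mk⇔ (JT-hard⇒BLR-hard em B) (BLR-hard⇒JT-hard em B)
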